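{- Let $q$ be a prime power. Let $C_i$ be a $(v_i,N_i,d_i;k)_q$ constant dimension code for $i=1,2$, let $d\in 2\mathbb{N}_{\ge 0}$ (i.e., $d$ is a nonnegative even integer), and let $C_r$ be a $(k\times(v_2-k+d/2),N_r,d_r)_q$ linear rank metric code. Then $$\mathcal{C}=\{\tau^{ -1}(\tau(U)\mid M) : U\in C_1,\ M\in C_r\}\ \cup\ \{\tau^{ -1}(0_{k\times(v_1-k+d/2)}\mid\tau(W)) : W\in C_2\}$$ is a $(v_1+v_2-k+d/2,\ N_1N_r+N_2,\ \min\{d_1,d_2,2d_r,d\};\ k)_q$ constant dimension code.
   Context: For subspaces $U,W$ of $\mathbb{F}_q^v$ the subspace distance is $\mathrm{d}_{\mathrm s}(U,W)=\dim(U)+\dim(W)-2\dim(U\cap W)$. A $(v,N,d;k)_q$ constant dimension code is a set of $N$ subspaces of $\mathbb{F}_q^v$, each of dimension $k\in\{0,1,\ldots,v\}$, with minimum subspace distance $d$. Here a code $\mathcal{C}$ has minimum distance $d$ if $d\le\mathrm{d}_{\mathrm s}(U,W)$ for all $U\neq W$ in $\mathcal{C}$ and equality is attained at least once; if $\#\mathcal{C}=1$, the minimum distance is set to $\infty$. An $(m\times n,N,d_r)_q$ rank metric code is a subset of $\mathbb{F}_q^{m\times n}$ of cardinality $N$ with minimum rank distance $d_r$, where the rank distance of matrices $A,B$ is $\mathrm{rk}(A-B)$ (the minimum rank distance of a one-element code is $\infty$); it is linear if it is an $\mathbb{F}_q$-subspace of $\mathbb{F}_q^{m\times n}$. For a $k$-dimensional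 subspace $U\le\mathbb{F}_q^v$, $\tau(U)\in\mathbb{F}_q^{k\times v}$ is the unique matrix in reduced row echelon form whose row space is $U$; $\tau$ is a bijection from the $k$-dimensional subspaces of $\mathbb{F}_q^v$ to the $k\times v$ matrices of rank $k$ in reduced row echelon form, and $\tau^{ -1}(X)$ is the row space of $X$. $A\mid B$ denotes the concatenation of two matrices with the same number of rows, and $0_{m\times n}$ is the $m\times n$ zero matrix.
   Formalization: The literal claim fails for d=0, for min{d1,d2,2d_r,d}>2k, and can fail if d<min{d1,d2,2d_r}. So d>0 and min{d1,d2,2d_r,d}≤2k are assumed, and the minimum distance is shown to be at least the stated minimum, with equality if min{d1,d2,2d_r}≤d. -}

module Defs where

open import Algebra.Bundles using (CommutativeRing)
import Algebra.Properties.Semiring.Sum as Sum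
open import Data.Fin.Base as Fin using (Fin)
open import Data.Nat.Base as ℕ using (ℕ; _∸_; _^_; _<_; _≤_)
open import Data.Nat.Primality using (Prime)
import Data.Nat.Properties as ℕₚ
open import Data.Product.Base using (_×_; _,_; ∃; ∃-syntax; proj₁)
open import Data.Sum.Base using (_⊎_)
open import Data.Vec.Functional using (Vector; zipWith; replicate; _++_)
import Data.Vec.Functional.Relation.Binary.Equality.Setoid as VecEq
import Data.Vec.Functional.Relation.Binary.Pointwise.Properties as Pointwise
open import Function.Bundles using (Bijection)
open import Level using (Level; 0ℓ; _⊔_; suc)
open import Relation.Binary.Bundles using (Setoid)
import Relation.Binary.Construct.Add.Supremum.NonStrict as Supremum
import Relation.Binary.Construct.On as On
open import Relation.Binary.PropositionalEquality as ≡ using (_≡_)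
open import Relation.Nullary.Construct.Add.Supremum using (_⁺; [_]; ⊤⁺)
open import Relation.Nullary.Negation.Core using (¬_)
open import Relation.Unary using (Pred; _∈_; _∩_; _≐_)
open import Relation.Unary.Properties using (≐-refl; ≐-sym; ≐-trans)

private
  variable
    a ℓ p : Level

PrimePower : ℕ → Set
PrimePower q = ∃[ r ] ∃[ n ] (Prime r × 0 < n × q ≡ r ^ n)

-- Minimum distances live in ℕ ∪ {∞}, with ∞ = ⊤⁺.

ℕ∞ : Set
ℕ∞ = ℕ ⁺

open Supremum _≤_ public using () renaming (_≤⁺_ to _≤∞_)

infixl 7 _⊓∞_
infixr 8 2*∞_

_⊓∞_ : ℕ∞ → ℕ∞ → ℕ∞
[ m ] ⊓∞ [ n ] = [ m ℕ.⊓ n ]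
[ m ] ⊓∞ ⊤⁺    = [ m ]
⊤⁺    ⊓∞ n     = n

2*∞_ : ℕ∞ → ℕ∞
2*∞ [ n ] = [ 2 ℕ.* n ]
2*∞ ⊤⁺    = ⊤⁺

module _ (S : Setoid a ℓ) where
  open Setoid S using (Carrier; _≈_)

  HasCardinality : Pred Carrier p → ℕ → Set (a ⊔ ℓ ⊔ p)
  HasCardinality C N =
    Bijection (≡.setoid (Fin N)) (On.setoid {B = ∃ C} S proj₁)

  -- A distance is given by its graph: D x y t means that x and y are at
  -- distance t.

  HasMinimumDistance : (Carrier → Carrier → ℕ → Set) →
                       Pred Carrier p → ℕ∞ → Set (a ⊔ ℓ ⊔ p)
  HasMinimumDistance D C ⊤⁺    = HasCardinality C 1
  HasMinimumDistance D C [ d ] =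
    (∀ {x y t} → x ∈ C → y ∈ C → ¬ x ≈ y → D x y t → d ≤ t) ×
    (∃[ x ] ∃[ y ] (x ∈ C × y ∈ C × ¬ x ≈ y × D x y d))

record FiniteField (q : ℕ) : Set₁ where
  field
    commutativeRing : CommutativeRing 0ℓ 0ℓ

  open CommutativeRing commutativeRing public

  field
    1≉0         : ¬ 1# ≈ 0#
    inverse     : ∀ x → ¬ x ≈ 0# → ∃[ y ] (x * y ≈ 1#)
    enumeration : Bijection (≡.setoid (Fin q)) setoid

module Codes {q : ℕ} (F : FiniteField q) where
  open FiniteField F
  open Sum semiring
    using (sum; sum-cong-≋; sum-replicate-zero; ∑-distrib-+; *-distribˡ-sum)
  open VecEq setoid using (_≋_)

  private
    variable
      k l m n v : ℕ

  Vec : ℕ → Set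
  Vec = Vector Carrier

  Matrix : ℕ → ℕ → Set
  Matrix m n = Vector (Vec n) m

  matrixSetoid : ℕ → ℕ → Setoid 0ℓ 0ℓ
  matrixSetoid m n = Pointwise.setoid (Pointwise.setoid setoid n) m

  infixl 6 _+ᵛ_ _+ᴹ_ _-ᴹ_
  infixr 7 _*ᵛ_ _*ᴹ_

  0ᵛ : Vec n
  0ᵛ = replicate _ 0#

  _+ᵛ_ : Vec n → Vec n → Vec n
  _+ᵛ_ = zipWith _+_

  _*ᵛ_ : Carrier → Vec n → Vec n
  (s *ᵛ x) j = s * x j

  0ᴹ : ∀ m n → Matrix m n
  0ᴹ m n = replicate m 0ᵛ

  _+ᴹ_ : Matrix m n → Matrix m n → Matrix m n
  _+ᴹ_ = zipWith _+ᵛ_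

  _*ᴹ_ : Carrier → Matrix m n → Matrix m n
  (s *ᴹ A) i = s *ᵛ A i

  _-ᴹ_ : Matrix m n → Matrix m n → Matrix m n
  (A -ᴹ B) i j = A i j - B i j

  infixr 5 _∣∣_

  _∣∣_ : Matrix k m → Matrix k n → Matrix k (m ℕ.+ n)
  _∣∣_ = zipWith _++_

  castColumns : .(m ≡ n) → Matrix k m → Matrix k n
  castColumns eq A i j = A i (Fin.cast (≡.sym eq) j)

  combination : Vec m → Matrix m n → Vec n
  combination c A j = sum λ i → c i * A i j

  Span : Matrix m n → Pred (Vec n) 0ℓ
  Span A x = ∃[ c ] (x ≋ combination c A)

  LinearlyIndependent : Pred (Matrix m n) 0ℓ
  LinearlyIndependent A = ∀ c → combination c A ≋ 0ᵛ → c ≋ 0ᵛ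

  HasDimension : Pred (Vec v) 0ℓ → ℕ → Set
  HasDimension {v} P k =
    ∃[ b ] (LinearlyIndependent {k} {v} b × Span b ≐ P)

  record Subspace (v : ℕ) : Set₁ where
    field
      ⟦_⟧       : Pred (Vec v) 0ℓ
      respects  : ∀ {x y} → x ≋ y → x ∈ ⟦_⟧ → y ∈ ⟦_⟧
      0-closed  : 0ᵛ ∈ ⟦_⟧
      +-closed  : ∀ {x y} → x ∈ ⟦_⟧ → y ∈ ⟦_⟧ → x +ᵛ y ∈ ⟦_⟧
      *-closed  : ∀ s {x} → x ∈ ⟦_⟧ → s *ᵛ x ∈ ⟦_⟧

  open Subspace public using (⟦_⟧)

  infix 4 _≐ˢ_

  _≐ˢ_ : Subspace v → Subspace v → Set
  U ≐ˢ W = ⟦ U ⟧ ≐ ⟦ W ⟧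

  subspaceSetoid : ℕ → Setoid (suc 0ℓ) 0ℓ
  subspaceSetoid v = record
    { Carrier       = Subspace v
    ; _≈_           = _≐ˢ_
    ; isEquivalence = record
      { refl  = ≐-refl
      ; sym   = ≐-sym
      ; trans = ≐-trans
      }
    }

  rowSpace : Matrix m v → Subspace v
  rowSpace {m} A = record
    { ⟦_⟧      = Span A
    ; respects = λ x≋y (c , eq) → c , λ j → trans (sym (x≋y j)) (eq j)
    ; 0-closed = 0ᵛ , λ j → sym (trans
        (sum-cong-≋ (λ i → zeroˡ (A i j))) (sum-replicate-zero m))
    ; +-closed = λ (c , eq) (e , eq′) → c +ᵛ e , λ j → trans
        (+-cong (eq j) (eq′ j)) (trans
        (sym (∑-distrib-+ (λ i → c i * A i j) (λ i → e i * A i j)))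
        (sum-cong-≋ (λ i → sym (distribʳ (A i j) (c i) (e i)))))
    ; *-closed = λ s (c , eq) → s *ᵛ c , λ j → trans
        (*-congˡ (eq j)) (trans
        (*-distribˡ-sum s (λ i → c i * A i j))
        (sum-cong-≋ (λ i → sym (*-assoc s (c i) (A i j)))))
    }

  SubspaceDistance : Subspace v → Subspace v → ℕ → Set
  SubspaceDistance U W t = ∃[ a ] ∃[ b ] ∃[ c ]
    ( HasDimension ⟦ U ⟧ a × HasDimension ⟦ W ⟧ b
    × HasDimension (⟦ U ⟧ ∩ ⟦ W ⟧) c
    × t ≡ a ℕ.+ b ∸ 2 ℕ.* c )

  HasRank : Matrix m n → ℕ → Set
  HasRank A = HasDimension (Span A)

  RankDistance : Matrix m n → Matrix m n → ℕ → Set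
  RankDistance A B = HasRank (A -ᴹ B)

  SubspaceCode : ℕ → Set₂
  SubspaceCode v = Pred (Subspace v) (suc 0ℓ)

  record IsConstantDimensionCode (v N : ℕ) (d : ℕ∞) (k : ℕ)
                                 (C : SubspaceCode v) : Set₁ where
    field
      k≤v             : k ≤ v
      cardinality     : HasCardinality (subspaceSetoid v) C N
      dimension       : ∀ {U} → U ∈ C → HasDimension ⟦ U ⟧ k
      minimumDistance : HasMinimumDistance (subspaceSetoid v)
                          SubspaceDistance C d

  MatrixCode : ℕ → ℕ → Set₁
  MatrixCode m n = Pred (Matrix m n) 0ℓ

  record IsRankMetricCode (m n N : ℕ) (d : ℕ∞) (C : MatrixCode m n) : Set where
    field
      cardinality     : HasCardinality (matrixSetoid m n) C N
      minimumDistance : HasMinimumDistance (matrixSetoid m n) RankDistance C d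

  record IsLinear {m n : ℕ} (C : MatrixCode m n) : Set where
    open Setoid (matrixSetoid m n) using () renaming (_≈_ to _≈ᴹ_)
    field
      respects : ∀ {A B} → A ≈ᴹ B → A ∈ C → B ∈ C
      0-closed : 0ᴹ m n ∈ C
      +-closed : ∀ {A B} → A ∈ C → B ∈ C → A +ᴹ B ∈ C
      *-closed : ∀ s {A} → A ∈ C → s *ᴹ A ∈ C

  LeadingOneAt : Vec n → Fin n → Set
  LeadingOneAt x j = x j ≈ 1# × (∀ {j′} → j′ Fin.< j → x j′ ≈ 0#)

  record IsRREF (A : Matrix m n) : Set where
    field
      zeroOrLeadingOne : ∀ i → A i ≋ 0ᵛ ⊎ ∃ (LeadingOneAt (A i))
      zeroRowsLast     : ∀ {i i′} → i Fin.< i′ → A i ≋ 0ᵛ → A i′ ≋ 0ᵛ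
      staircase        : ∀ {i i′ j j′} → i Fin.< i′ →
                         LeadingOneAt (A i) j → LeadingOneAt (A i′) j′ →
                         j Fin.< j′
      reduced          : ∀ {i i′ j} → ¬ i′ ≡ i →
                         LeadingOneAt (A i) j → A i′ j ≈ 0#

  -- The graph of τ on the k-dimensional subspaces; the inverse of τ is
  -- rowSpace.

  IsTau : Subspace v → Matrix k v → Set
  IsTau U X = IsRREF X × rowSpace X ≐ˢ U

  module _ {v₁ v₂ k : ℕ} (k≤v₁ : k ≤ v₁) (k≤v₂ : k ≤ v₂) (e : ℕ) where

    leftWidth : v₁ ℕ.+ (v₂ ∸ k ℕ.+ e) ≡ v₁ ℕ.+ v₂ ∸ k ℕ.+ e
    leftWidth = ≡.trans (≡.sym (ℕₚ.+-assoc v₁ (v₂ ∸ k) e))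
      (≡.cong (ℕ._+ e) (≡.sym (ℕₚ.+-∸-assoc v₁ k≤v₂)))

    rightWidth : v₁ ∸ k ℕ.+ e ℕ.+ v₂ ≡ v₁ ℕ.+ v₂ ∸ k ℕ.+ e
    rightWidth = ≡.trans (ℕₚ.+-assoc (v₁ ∸ k) e v₂)
      (≡.trans (≡.cong (v₁ ∸ k ℕ.+_) (ℕₚ.+-comm e v₂))
      (≡.trans (≡.sym (ℕₚ.+-assoc (v₁ ∸ k) v₂ e))
      (≡.cong (ℕ._+ e) (≡.sym (ℕₚ.+-∸-comm v₂ k≤v₁)))))

    linkage : SubspaceCode v₁ → SubspaceCode v₂ →
              MatrixCode k (v₂ ∸ k ℕ.+ e) →
              SubspaceCode (v₁ ℕ.+ v₂ ∸ k ℕ.+ e)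
    linkage C₁ C₂ Cᵣ V =
      (∃[ U ] ∃[ X ] ∃[ M ]
        ( U ∈ C₁ × IsTau U X × M ∈ Cᵣ
        × V ≐ˢ rowSpace (castColumns leftWidth (X ∣∣ M)) ))
      ⊎
      (∃[ W ] ∃[ Y ]
        ( W ∈ C₂ × IsTau W Y
        × V ≐ˢ rowSpace (castColumns rightWidth (0ᴹ k (v₁ ∸ k ℕ.+ e) ∣∣ Y)) ))

{-# OPTIONS --safe #-}
module Submission where

open import Defs

-- Write X, X′ for the reduced row echelon forms of codewords of C₁ and Y for one
-- of C₂.  The rows of X are independent, so a vector of the row space of (X | M)
-- is determined by its first v₁ entries.
--
-- * (X | M) and (X′ | M′) with X ≠ X′: projecting to the first v₁ entries embeds
--   the intersection into that of the two codewords of C₁, and for M = M′ = 0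
--   the embedding is onto; linearity of Cᵣ provides 0.
-- * (X | M) and (X | M′): the intersection is isomorphic to the left kernel of
--   M − M′, so the distance is 2 rk(M − M′) by rank-nullity.
-- * (0 | Y) and (0 | Y′): the intersection is that of the codewords of C₂.
-- * (X | M) and (0 | Y): a common vector vanishes on the first v₁ − k + d/2
--   entries, so at most k − d/2 of the first v₁ remain and the distance is at
--   least min(d, 2k).
--
-- The first three cases attain d₁, 2 dᵣ and d₂.

import Algebra.Properties.Group as GroupProperties
import Algebra.Properties.Ring as RingProperties
import Algebra.Properties.Semiring.Sum as Sum
open import Data.Fin.Base as Fin using (Fin; zero; suc; toℕ; _↑ˡ_; _↑ʳ_)
import Data.Fin.Properties as Finₚ
open import Data.Nat.Base as ℕ using (ℕ; zero; suc; z≤n; s≤s; _∸_)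
import Data.Nat.Properties as ℕₚ
open import Data.Nat.Tactic.RingSolver using (solve-∀)
open import Data.Product.Base using (_×_; _,_; ∃; ∃-syntax; proj₁; proj₂)
open import Data.Sum.Base as ⊎ using (_⊎_; inj₁; inj₂)
open import Data.Sum.Function.Propositional using (_⊎-↔_)
open import Data.Vec.Functional as Vector using (_∷_)
import Data.Vec.Functional.Properties as Vectorₚ
import Data.Vec.Functional.Relation.Binary.Equality.Setoid as VecEq
open import Function.Base using (_∘_)
open import Function.Bundles using (Bijection; Inverse; _↔_)
open import Function.Properties.Inverse using (↔-refl; ↔-trans)
open import Level using (Level; 0ℓ)
open import Relation.Binary.Bundles using (Setoid)
import Relation.Binary.Construct.Add.Supremum.NonStrict as Supremum
open import Relation.Binary.Definitions using (Decidable; tri<; tri≈; tri>)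
open import Relation.Binary.PropositionalEquality as ≡ using (_≡_; _≢_)
import Relation.Binary.Reasoning.Setoid as SetoidReasoning
open import Relation.Nullary.Construct.Add.Supremum using ([_]; ⊤⁺)
open import Relation.Nullary.Decidable using (Dec; yes; no; map′; _×-dec_; ¬?)
open import Relation.Nullary.Negation.Core using (¬_; contradiction)
open import Relation.Unary as Unary using (Pred; _∈_; _∩_; _≐_)
open import Relation.Unary.Algebra using (∩-comm)
open import Relation.Unary.Properties using (≐-refl; ≐-sym; ≐-trans)

-- A dimension is a number for which some basis exists, so a distance must be produced before it can
-- be bounded. Finiteness of the field makes membership in a span decidable; elimination then gives
-- an echelon basis of every decidable subspace, hence both the dimensions of intersections and the
-- existence of τ. Dimensions are compared by counting, so maps between subspaces must be injective
-- but are never shown to be linear. The hypotheses on d and k come from the mixed pairs. Two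
-- subspaces of dimension k are at distance at most 2k, so with one-element codes and d > 2k the
-- bound by d fails. For d = 0 a codeword (X | M) may equal some (0 | Y): take X = (0 | I) and Y =
-- (I | M). If μ = min(d₁, d₂, 2 dᵣ) exceeds d, every mixed pair may be farther apart than d; hence
-- equality is claimed for μ ≤ d, and the lower bound min(μ, d) in general.

private
  variable
    a ℓ p : Level
    k m n r v w : ℕ

-- Finite index sets and powers.

∃≢⇒1< : {i j : Fin n} → i ≢ j → 1 ℕ.< n
∃≢⇒1< {suc zero}    {zero} {zero} i≢j = contradiction ≡.refl i≢j
∃≢⇒1< {suc (suc n)} i≢j = s≤s (s≤s z≤n)

^-cancelˡ-≤ : 1 ℕ.< k → k ℕ.^ m ℕ.≤ k ℕ.^ n → m ℕ.≤ n
^-cancelˡ-≤ {k} {m} {n} 1<k le = ℕₚ.≮⇒≥ λ n<m →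
  ℕₚ.<⇒≱ (ℕₚ.^-monoʳ-< k 1<k n<m) le

funToFin-cong : {f g : Fin m → Fin n} → (∀ i → f i ≡ g i) →
                Fin.funToFin f ≡ Fin.funToFin g
funToFin-cong {zero}  f≗g = ≡.refl
funToFin-cong {suc m} f≗g =
  ≡.cong₂ Fin.combine (f≗g zero) (funToFin-cong (f≗g ∘ suc))

-- Each step raises the value by at least one. The induction replaces `σ` by its restriction along
-- `Fin.inject₁`, because `Fin.inject₁ i` is the predecessor of `suc i` in the same index type. It
-- is applied below to the map that matches the pivots of two echelon forms.
strictlyMonotone⇒inflationary :
  (σ : Fin m → Fin n) → (∀ {i j} → i Fin.< j → σ i Fin.< σ j) →
  ∀ i → i Fin.≤ σ i
strictlyMonotone⇒inflationary σ mono zero    = z≤n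
strictlyMonotone⇒inflationary σ mono (suc i) = ℕₚ.≤-<-trans
  (strictlyMonotone⇒inflationary (σ ∘ Fin.inject₁)
    (λ i<j → mono (≡.subst₂ ℕ._<_
      (≡.sym (Finₚ.toℕ-inject₁ _)) (≡.sym (Finₚ.toℕ-inject₁ _)) i<j)) i)
  (mono (s≤s (ℕₚ.≤-reflexive (Finₚ.toℕ-inject₁ i))))

module LinearAlgebra {q : ℕ} (F : FiniteField q) where
  open FiniteField F hiding (zero)
  open Codes F
  open VecEq setoid using (_≋_; ≋-refl; ≋-sym; ≋-trans)
  open Sum semiring
    using (sum; sum-cong-≋; sum-replicate-zero; sum-remove; ∑-comm;
           ∑-distrib-+; *-distribˡ-sum; *-distribʳ-sum)
  open GroupProperties +-group
    using (//-rightDividesˡ; //-rightDividesʳ; ε⁻¹≈ε; x∙y⁻¹≈ε⇒x≈y)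
  open RingProperties ring using (-1*x≈-x; +-cancelˡ)
  open SetoidReasoning setoid

  -- The finite field: decidable equality and counting of vectors.

  element : Fin q → Carrier
  element = Bijection.to enumeration

  index : Carrier → Fin q
  index x = proj₁ (Bijection.strictlySurjective enumeration x)

  element-index : ∀ x → element (index x) ≈ x
  element-index x = proj₂ (Bijection.strictlySurjective enumeration x)

  index-injective : ∀ {x y} → index x ≡ index y → x ≈ y
  index-injective {x} {y} eq = trans (sym (element-index x))
    (trans (reflexive (≡.cong element eq)) (element-index y))

  index-cong : ∀ {x y} → x ≈ y → index x ≡ index y
  index-cong {x} {y} x≈y = Bijection.injective enumeration
    (trans (element-index x) (trans x≈y (sym (element-index y))))

  infix 4 _≟_ _≋?_

  _≟_ : Decidable _≈_
  x ≟ y = map′ index-injective index-cong (index x Finₚ.≟ index y)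

  _≋?_ : Decidable (_≋_ {n})
  x ≋? y = Finₚ.all? λ i → x i ≟ y i

  1<q : 1 ℕ.< q
  1<q = ∃≢⇒1< λ eq → 1≉0 (index-injective eq)

  vecIndex : Vec n → Fin (q ℕ.^ n)
  vecIndex x = Fin.funToFin (index ∘ x)

  vecElement : Fin (q ℕ.^ n) → Vec n
  vecElement i = element ∘ Fin.finToFun i

  vecElement-vecIndex : (x : Vec n) → vecElement (vecIndex x) ≋ x
  vecElement-vecIndex x i = trans
    (reflexive (≡.cong element (Finₚ.finToFun-funToFin (index ∘ x) i)))
    (element-index (x i))

  vecIndex-injective : {x y : Vec n} → vecIndex x ≡ vecIndex y → x ≋ y
  vecIndex-injective {x = x} {y} eq = ≋-trans (≋-sym (vecElement-vecIndex x))
    (≋-trans (λ i → reflexive (≡.cong (λ h → vecElement h i) eq))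
      (vecElement-vecIndex y))

  vecElement-injective : ∀ {i j : Fin (q ℕ.^ n)} →
                         vecElement {n} i ≋ vecElement {n} j → i ≡ j
  vecElement-injective {n} {i} {j} eq = ≡.trans
    (≡.sym (Finₚ.funToFin-finToFin {n} i)) (≡.trans
    (funToFin-cong (λ h → Bijection.injective enumeration (eq h)))
    (Finₚ.funToFin-finToFin {n} j))

  -- Counting replaces the Steinitz exchange lemma: |Fᵐ| ≤ |Fⁿ| forces m ≤ n.
  injection⇒≤ : (f : Vec m → Vec n) → (∀ {x y} → f x ≋ f y → x ≋ y) → m ℕ.≤ n
  injection⇒≤ {m} {n} f inj = ^-cancelˡ-≤ 1<q
    (Finₚ.injective⇒≤ {f = vecIndex ∘ f ∘ vecElement {m}}
      (λ eq → vecElement-injective {m} (inj (vecIndex-injective eq))))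

  -- The search runs over the q ^ n codes of vectors. Decoding a code returns the vector only up to
  -- `_≋_`, so `P` must respect that relation.
  anyVec? : {P : Pred (Vec n) p} → (∀ {x y} → x ≋ y → P x → P y) →
            Unary.Decidable P → Dec (∃ P)
  anyVec? resp P? = map′ (λ (i , Pi) → vecElement i , Pi)
    (λ (x , Px) → vecIndex x , resp (≋-sym (vecElement-vecIndex x)) Px)
    (Finₚ.any? (P? ∘ vecElement))

  -- Linear combinations and spans.

  infixl 6 _-ᵛ_

  _-ᵛ_ : Vec n → Vec n → Vec n
  _-ᵛ_ = Vector.zipWith _-_

  -‿cong₂ : ∀ {x x′ y y′} → x ≈ x′ → y ≈ y′ → x - y ≈ x′ - y′
  -‿cong₂ x≈ y≈ = +-cong x≈ (-‿cong y≈)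

  x-0≈x : ∀ x → x - 0# ≈ x
  x-0≈x x = trans (+-congˡ ε⁻¹≈ε) (+-identityʳ x)

  sum-zero : {f : Vec n} → f ≋ 0ᵛ → sum f ≈ 0#
  sum-zero {n} f≋0 = trans (sum-cong-≋ f≋0) (sum-replicate-zero n)

  sum-single : (f : Vec n) → ∀ i → (∀ j → j ≢ i → f j ≈ 0#) → sum f ≈ f i
  sum-single {suc n} f i f≈0 = begin
    sum f                           ≈⟨ sum-remove f ⟩
    f i + sum (Vector.removeAt f i) ≈⟨ +-congˡ (sum-zero λ j →
                                         f≈0 _ (Finₚ.punchInᵢ≢i i j)) ⟩
    f i + 0#                        ≈⟨ +-identityʳ (f i) ⟩
    f i                             ∎

  combination-cong : {c e : Vec m} {A B : Matrix m n} → c ≋ e →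
                     (∀ i → A i ≋ B i) → combination c A ≋ combination e B
  combination-cong c≋e A≋B j = sum-cong-≋ λ i → *-cong (c≋e i) (A≋B i j)

  combination-congˡ : {c e : Vec m} (A : Matrix m n) → c ≋ e →
                      combination c A ≋ combination e A
  combination-congˡ A c≋e = combination-cong {A = A} c≋e λ i → ≋-refl

  combination-+ : (c e : Vec m) (A : Matrix m n) →
                  combination (c +ᵛ e) A ≋ combination c A +ᵛ combination e A
  combination-+ c e A j = trans
    (sum-cong-≋ λ i → distribʳ (A i j) (c i) (e i))
    (∑-distrib-+ (λ i → c i * A i j) (λ i → e i * A i j))

  -- Since (c - e) + e = c, additivity already gives the rule for differences, and no rule for
  -- negated sums enters.
  combination-minus : (c e : Vec m) (A : Matrix m n) →
                  combination (c -ᵛ e) A ≋ combination c A -ᵛ combination e A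
  combination-minus c e A j = begin
    combination (c -ᵛ e) A j
      ≈⟨ //-rightDividesʳ (combination e A j) _ ⟨
    combination (c -ᵛ e) A j + combination e A j - combination e A j
      ≈⟨ +-congʳ (combination-+ (c -ᵛ e) e A j) ⟨
    combination ((c -ᵛ e) +ᵛ e) A j - combination e A j
      ≈⟨ +-congʳ (combination-congˡ A (λ i → //-rightDividesˡ (e i) (c i)) j) ⟩
    combination c A j - combination e A j ∎

  combination-+ʳ : (c : Vec m) (A B : Matrix m n) →
                   combination c (A +ᴹ B) ≋ combination c A +ᵛ combination c B
  combination-+ʳ c A B j = trans
    (sum-cong-≋ λ i → distribˡ (c i) (A i j) (B i j))
    (∑-distrib-+ (λ i → c i * A i j) (λ i → c i * B i j))

  combination-minusʳ : (c : Vec m) (A B : Matrix m n) →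
                   combination c (A -ᴹ B) ≋ combination c A -ᵛ combination c B
  combination-minusʳ c A B j = begin
    combination c (A -ᴹ B) j
      ≈⟨ //-rightDividesʳ (combination c B j) _ ⟨
    combination c (A -ᴹ B) j + combination c B j - combination c B j
      ≈⟨ +-congʳ (combination-+ʳ c (A -ᴹ B) B j) ⟨
    combination c ((A -ᴹ B) +ᴹ B) j - combination c B j
      ≈⟨ +-congʳ (combination-cong {c = c} ≋-refl
           (λ i l → //-rightDividesˡ (B i l) (A i l)) j) ⟩
    combination c A j - combination c B j ∎

  combination-* : ∀ s (c : Vec m) (A : Matrix m n) →
                  combination (s *ᵛ c) A ≋ s *ᵛ combination c A
  combination-* s c A j = trans (sum-cong-≋ λ i → *-assoc s (c i) (A i j))
    (sym (*-distribˡ-sum s (λ i → c i * A i j)))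

  combination-zeroˡ : {c : Vec m} (A : Matrix m n) → c ≋ 0ᵛ →
                      combination c A ≋ 0ᵛ
  combination-zeroˡ A c≋0 j = sum-zero λ i → trans (*-congʳ (c≋0 i)) (zeroˡ _)

  combination-zeroʳ : (c : Vec m) {A : Matrix m n} {j : Fin n} →
                      (∀ i → A i j ≈ 0#) → combination c A j ≈ 0#
  combination-zeroʳ c A≈0 = sum-zero λ i → trans (*-congˡ (A≈0 i)) (zeroʳ _)

  -- Associativity of the matrix product, c(DA) = (cD)A, by exchanging the two sums.
  combination-assoc : (c : Vec m) (D : Matrix m n) (A : Matrix n v) →
    combination c (λ i → combination (D i) A) ≋ combination (combination c D) A
  combination-assoc c D A l = begin
    sum (λ i → c i * sum (λ j → D i j * A j l))
      ≈⟨ sum-cong-≋ (λ i → *-distribˡ-sum (c i) λ j → D i j * A j l) ⟩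
    sum (λ i → sum (λ j → c i * (D i j * A j l)))
      ≈⟨ ∑-comm (λ i j → c i * (D i j * A j l)) ⟩
    sum (λ j → sum (λ i → c i * (D i j * A j l)))
      ≈⟨ sum-cong-≋ (λ j → sum-cong-≋ λ i → sym (*-assoc (c i) (D i j) (A j l))) ⟩
    sum (λ j → sum (λ i → c i * D i j * A j l))
      ≈⟨ sum-cong-≋ (λ j → *-distribʳ-sum (A j l) λ i → c i * D i j) ⟨
    sum (λ j → sum (λ i → c i * D i j) * A j l) ∎

  combination-unit : (c : Vec m) (A : Matrix m n) → ∀ i → c i ≈ 1# →
                     (∀ j → j ≢ i → c j ≈ 0#) → combination c A ≋ A i
  combination-unit c A i ci≈1 cj≈0 l = trans
    (sum-single (λ j → c j * A j l) i
      (λ j j≢i → trans (*-congʳ (cj≈0 j j≢i)) (zeroˡ _)))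
    (trans (*-congʳ ci≈1) (*-identityˡ _))

  unit : Fin n → Vec n
  unit i j with i Finₚ.≟ j
  ... | yes _ = 1#
  ... | no  _ = 0#

  unit-diagonal : (i : Fin n) → unit i i ≈ 1#
  unit-diagonal i with i Finₚ.≟ i
  ... | yes _  = refl
  ... | no i≢i = contradiction ≡.refl i≢i

  unit-offDiagonal : (i j : Fin n) → j ≢ i → unit i j ≈ 0#
  unit-offDiagonal i j j≢i with i Finₚ.≟ j
  ... | yes i≡j = contradiction (≡.sym i≡j) j≢i
  ... | no _    = refl

  row∈Span : (A : Matrix m n) → ∀ i → A i ∈ Span A
  row∈Span A i = unit i , ≋-sym
    (combination-unit (unit i) A i (unit-diagonal i) (unit-offDiagonal i))

  module _ (U : Subspace n) where
    open Subspace U hiding (⟦_⟧)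

    -‿closed : ∀ {x y} → x ∈ ⟦ U ⟧ → y ∈ ⟦ U ⟧ → (x -ᵛ y) ∈ ⟦ U ⟧
    -‿closed x∈U y∈U = respects (λ i → +-congˡ (-1*x≈-x _))
      (+-closed x∈U (*-closed (- 1#) y∈U))

    combination-closed : (c : Vec m) (A : Matrix m n) → (∀ i → A i ∈ ⟦ U ⟧) →
                         combination c A ∈ ⟦ U ⟧
    combination-closed {zero}  c A A∈U = 0-closed
    combination-closed {suc m} c A A∈U = +-closed
      (*-closed (c zero) (A∈U zero))
      (combination-closed (c ∘ suc) (A ∘ suc) (A∈U ∘ suc))

  Span-cong : {A B : Matrix m n} → (∀ i → A i ≋ B i) → Span A ≐ Span B
  Span-cong A≋B =
    (λ (c , x≋) → c , ≋-trans x≋ (combination-cong {c = c} ≋-refl A≋B)) ,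
    (λ (c , x≋) → c , ≋-trans x≋ (combination-cong {c = c} ≋-refl (≋-sym ∘ A≋B)))

  independent-injective : {A : Matrix m n} → LinearlyIndependent A →
    ∀ {c e} → combination c A ≋ combination e A → c ≋ e
  independent-injective {A = A} indep {c} {e} eq i = x∙y⁻¹≈ε⇒x≈y (c i) (e i)
    (indep (c -ᵛ e) (λ j → trans (combination-minus c e A j)
      (trans (+-congʳ (eq j)) (-‿inverseʳ _))) i)

  Span? : (A : Matrix m n) → Unary.Decidable (Span A)
  Span? A x = anyVec?
    (λ c≋e x≋ → ≋-trans x≋ (combination-congˡ A c≋e))
    (λ c → x ≋? combination c A)

  -- Dimension.

  HasDimension-cong : {P Q : Pred (Vec v) 0ℓ} → P ≐ Q →
                      HasDimension P k → HasDimension Q k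
  HasDimension-cong P≐Q (b , indep , Span≐P) = b , indep , ≐-trans Span≐P P≐Q

  ∈? : {P : Pred (Vec v) 0ℓ} → HasDimension P k → Unary.Decidable P
  ∈? (b , _ , ⊆P , P⊆) x = map′ ⊆P P⊆ (Span? b x)

  -- A basis of `P` embeds the vectors of length `k` into `P`, and `φ` embeds `P` into those of
  -- length `n`, so counting applies. `φ` receives the membership proof and can therefore read off
  -- coefficients; it need not be linear.
  dimension-≤ : {P : Pred (Vec v) 0ℓ} → HasDimension P k →
    (φ : ∀ {x} → x ∈ P → Vec n) →
    (∀ {x y} (x∈P : x ∈ P) (y∈P : y ∈ P) → φ x∈P ≋ φ y∈P → x ≋ y) → k ℕ.≤ n
  dimension-≤ (b , indep , ⊆P , _) φ inj = injection⇒≤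
    (λ c → φ (⊆P (c , ≋-refl)))
    (λ eq → independent-injective indep (inj _ _ eq))

  dimension-mono : {P : Pred (Vec v) 0ℓ} {Q : Pred (Vec w) 0ℓ} →
    HasDimension P k → HasDimension Q n →
    (φ : ∀ {x} → x ∈ P → Vec w) → (∀ {x} (x∈P : x ∈ P) → φ x∈P ∈ Q) →
    (∀ {x y} (x∈P : x ∈ P) (y∈P : y ∈ P) → φ x∈P ≋ φ y∈P → x ≋ y) → k ℕ.≤ n
  dimension-mono dimP (b , _ , _ , Q⊆) φ φ∈Q inj = dimension-≤ dimP
    (λ x∈P → proj₁ (Q⊆ (φ∈Q x∈P)))
    (λ x∈P y∈P eq → inj x∈P y∈P (≋-trans (proj₂ (Q⊆ (φ∈Q x∈P)))
      (≋-trans (combination-congˡ b eq) (≋-sym (proj₂ (Q⊆ (φ∈Q y∈P)))))))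

  dimension-⊆ : {P Q : Pred (Vec v) 0ℓ} → HasDimension P k → HasDimension Q n →
                (∀ {x} → x ∈ P → x ∈ Q) → k ℕ.≤ n
  dimension-⊆ dimP dimQ P⊆Q =
    dimension-mono dimP dimQ (λ {x} _ → x) P⊆Q (λ _ _ eq → eq)

  dimension-unique : {P Q : Pred (Vec v) 0ℓ} → P ≐ Q →
                     HasDimension P k → HasDimension Q n → k ≡ n
  dimension-unique (P⊆Q , Q⊆P) dimP dimQ =
    ℕₚ.≤-antisym (dimension-⊆ dimP dimQ P⊆Q) (dimension-⊆ dimQ dimP Q⊆P)

  -- Left kernels and rank-nullity.

  Kernel : Matrix m n → Subspace m
  Kernel B = record
    { ⟦_⟧      = λ c → combination c B ≋ 0ᵛ
    ; respects = λ c≋e cB≋0 → ≋-trans (combination-congˡ B (≋-sym c≋e)) cB≋0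
    ; 0-closed = combination-zeroˡ B ≋-refl
    ; +-closed = λ {c} {e} cB≋0 eB≋0 j → trans (combination-+ c e B j)
        (trans (+-cong (cB≋0 j) (eB≋0 j)) (+-identityʳ 0#))
    ; *-closed = λ s {c} cB≋0 j → trans (combination-* s c B j)
        (trans (*-congˡ (cB≋0 j)) (zeroʳ s))
    }

  ++-elim : (P : Pred (Fin (m ℕ.+ n)) p) → (∀ i → P (i ↑ˡ n)) →
            (∀ j → P (m ↑ʳ j)) → ∀ i → P i
  ++-elim {m} {n} P l r i =
    ≡.subst P (Finₚ.join-splitAt m n i)
      (⊎.[_,_] {C = P ∘ Fin.join m n} l r (Fin.splitAt m i))

  module _ (B : Matrix m n) {s} (rank : HasRank B r)
           (nullity : HasDimension ⟦ Kernel B ⟧ s) where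

    private
      b : Matrix r n
      b = proj₁ rank

      Z : Matrix s m
      Z = proj₁ nullity

      -- Row `i` is a preimage of the basis vector `b i` under x ↦ xB: the coefficients that write
      -- `b i` in terms of the rows of `B`.
      lift : Matrix r m
      lift i = proj₁ (proj₁ (proj₂ (proj₂ rank)) (row∈Span b i))

      lift-combination : ∀ y → combination (combination y lift) B ≋ combination y b
      lift-combination y = ≋-trans (≋-sym (combination-assoc y lift B))
        (combination-cong {c = y} ≋-refl
          λ i → ≋-sym (proj₂ (proj₁ (proj₂ (proj₂ rank)) (row∈Span b i))))

      Z-combination : ∀ z → combination (combination z Z) B ≋ 0ᵛ
      Z-combination z = proj₁ (proj₂ (proj₂ nullity)) (z , ≋-refl)

      f : Vec (r ℕ.+ s) → Vec m
      f x = combination (Vector.take r x) lift +ᵛ combination (Vector.drop r x) Z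

      f-image : ∀ x → combination (f x) B ≋ combination (Vector.take r x) b
      f-image x j = begin
        combination (f x) B j
          ≈⟨ combination-+ _ _ B j ⟩
        combination (combination (Vector.take r x) lift) B j
          + combination (combination (Vector.drop r x) Z) B j
          ≈⟨ +-cong (lift-combination _ j) (Z-combination _ j) ⟩
        combination (Vector.take r x) b j + 0#
          ≈⟨ +-identityʳ _ ⟩
        combination (Vector.take r x) b j ∎

      f-injective : ∀ {x x′} → f x ≋ f x′ → x ≋ x′
      f-injective {x} {x′} eq = ++-elim _ take-eq drop-eq
        where
        take-eq : Vector.take r x ≋ Vector.take r x′
        take-eq = independent-injective (proj₁ (proj₂ rank))
          (≋-trans (≋-sym (f-image x))
            (≋-trans (combination-congˡ B eq) (f-image x′)))

        drop-eq : Vector.drop r x ≋ Vector.drop r x′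
        drop-eq = independent-injective (proj₁ (proj₂ nullity)) λ j →
          +-cancelˡ _ _ _ (trans (eq j)
            (+-congʳ (sym (combination-congˡ lift take-eq j))))

      y-of : Vec m → Vec r
      y-of x = proj₁ (proj₂ (proj₂ (proj₂ rank)) (x , ≋-refl))

      remainder∈Kernel : ∀ x → (x -ᵛ combination (y-of x) lift) ∈ ⟦ Kernel B ⟧
      remainder∈Kernel x j = begin
        combination (x -ᵛ combination (y-of x) lift) B j
          ≈⟨ combination-minus x _ B j ⟩
        combination x B j - combination (combination (y-of x) lift) B j
          ≈⟨ -‿cong₂ (proj₂ (proj₂ (proj₂ (proj₂ rank)) (x , ≋-refl)) j)
                     (lift-combination (y-of x) j) ⟩
        combination (y-of x) b j - combination (y-of x) b j
          ≈⟨ -‿inverseʳ _ ⟩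
        0# ∎

      z-of : Vec m → Vec s
      z-of x = proj₁ (proj₂ (proj₂ (proj₂ nullity)) (remainder∈Kernel x))

      g : Vec m → Vec (r ℕ.+ s)
      g x = y-of x Vector.++ z-of x

      f-g : ∀ x → f (g x) ≋ x
      f-g x j = begin
        f (g x) j
          ≈⟨ +-cong
               (combination-congˡ lift
                 (λ i → reflexive (Vectorₚ.lookup-++ˡ (y-of x) (z-of x) i)) j)
               (combination-congˡ Z
                 (λ i → reflexive (Vectorₚ.lookup-++ʳ (y-of x) (z-of x) i)) j) ⟩
        combination (y-of x) lift j + combination (z-of x) Z j
          ≈⟨ +-congˡ (proj₂ (proj₂ (proj₂ (proj₂ nullity)) (remainder∈Kernel x)) j) ⟨
        combination (y-of x) lift j + (x j - combination (y-of x) lift j)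
          ≈⟨ +-comm _ _ ⟩
        x j - combination (y-of x) lift j + combination (y-of x) lift j
          ≈⟨ //-rightDividesˡ _ _ ⟩
        x j ∎

      g-injective : ∀ {x x′} → g x ≋ g x′ → x ≋ x′
      g-injective {x} {x′} eq = ≋-trans (≋-sym (f-g x)) (≋-trans
        (λ j → +-cong (combination-congˡ lift (eq ∘ (_↑ˡ s)) j)
                      (combination-congˡ Z (eq ∘ (r ↑ʳ_)) j))
        (f-g x′))

    -- `f` adds a kernel vector to a combination of lifted basis vectors: applying `B` recovers the
    -- first part, and independence of `Z` then recovers the second. `g` decomposes a vector in this
    -- way and is injective because `f` undoes it. Each injection gives one inequality by counting.
    rank-nullity : r ℕ.+ s ≡ m
    rank-nullity = ℕₚ.≤-antisym
      (injection⇒≤ f f-injective) (injection⇒≤ g g-injective)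

  -- Reduced row echelon forms without zero rows, and their uniqueness.

  record Echelon (X : Matrix r n) : Set where
    field
      pivot   : Fin r → Fin n
      leading : ∀ i → LeadingOneAt (X i) (pivot i)
      mono    : ∀ {i j} → i Fin.< j → pivot i Fin.< pivot j
      reduced : ∀ {i j} → j ≢ i → X j (pivot i) ≈ 0#

    -- A pivot column is a unit column, so the coefficients of a combination are visible among its
    -- entries. Independence and uniqueness of the form both rest on this.
    combination-pivot : ∀ c i → combination c X (pivot i) ≈ c i
    combination-pivot c i = begin
      combination c X (pivot i)
        ≈⟨ sum-single (λ j → c j * X j (pivot i)) i
             (λ j j≢i → trans (*-congˡ (reduced j≢i)) (zeroʳ (c j))) ⟩
      c i * X i (pivot i) ≈⟨ *-congˡ (proj₁ (leading i)) ⟩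
      c i * 1#            ≈⟨ *-identityʳ (c i) ⟩
      c i                 ∎

    coefficients : ∀ {x} (x∈ : x ∈ Span X) → ∀ i → x (pivot i) ≈ proj₁ x∈ i
    coefficients (c , x≋) i = trans (x≋ (pivot i)) (combination-pivot c i)

    independent : LinearlyIndependent X
    independent c cX≋0 i =
      trans (sym (combination-pivot c i)) (cX≋0 (pivot i))

    dimension : HasDimension (Span X) r
    dimension = X , independent , ≐-refl

  leadingOne-unique : {x : Vec n} {i j : Fin n} →
                      LeadingOneAt x i → LeadingOneAt x j → i ≡ j
  leadingOne-unique {i = i} {j} (xi≈1 , x<i) (xj≈1 , x<j) with Finₚ.<-cmp i j
  ... | tri< i<j _ _ = contradiction (trans (sym xi≈1) (x<j i<j)) 1≉0
  ... | tri≈ _ i≡j _ = i≡j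
  ... | tri> _ _ j<i = contradiction (trans (sym xj≈1) (x<i j<i)) 1≉0

  Echelon⇒IsRREF : {X : Matrix r n} → Echelon X → IsRREF X
  Echelon⇒IsRREF ech = record
    { zeroOrLeadingOne = λ i → inj₂ (pivot i , leading i)
    ; zeroRowsLast     = λ {i} _ Xi≋0 → contradiction
        (trans (sym (proj₁ (leading i))) (Xi≋0 (pivot i))) 1≉0
    ; staircase        = λ {i} {i′} i<i′ lead lead′ → ≡.subst₂ Fin._<_
        (leadingOne-unique (leading i) lead) (leadingOne-unique (leading i′) lead′)
        (mono i<i′)
    ; reduced          = λ {i} {i′} i′≢i lead → trans
        (reflexive (≡.cong _ (leadingOne-unique lead (leading i))))
        (reduced i′≢i)
    }
    where open Echelon ech

  noZeroRow : (A : Matrix r n) → HasDimension (Span A) r → ∀ i → ¬ A i ≋ 0ᵛ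
  noZeroRow {suc r} A dim i Ai≋0 = ℕₚ.1+n≰n (dimension-≤ dim
    (λ (c , _) → Vector.removeAt c i)
    (λ (c , x≋) (e , y≋) eq → ≋-trans x≋ (≋-trans
      (λ l → sum-cong-≋ λ j → term c e eq l j) (≋-sym y≋))))
    where
    term : ∀ c e → Vector.removeAt c i ≋ Vector.removeAt e i →
           ∀ l j → c j * A j l ≈ e j * A j l
    term c e eq l j with i Finₚ.≟ j
    ... | yes ≡.refl = trans (*-congˡ (Ai≋0 l)) (trans (zeroʳ (c i))
                         (sym (trans (*-congˡ (Ai≋0 l)) (zeroʳ (e i)))))
    ... | no i≢j     = *-congʳ (≡.subst (λ h → c h ≈ e h)
                         (Finₚ.punchIn-punchOut i≢j) (eq (Fin.punchOut i≢j)))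

  IsRREF⇒Echelon : {X : Matrix r n} → IsRREF X → HasDimension (Span X) r →
                   Echelon X
  IsRREF⇒Echelon {X = X} rref dim = record
    { pivot   = λ i → proj₁ (leadingOne i)
    ; leading = λ i → proj₂ (leadingOne i)
    ; mono    = λ i<j → staircase i<j (proj₂ (leadingOne _)) (proj₂ (leadingOne _))
    ; reduced = λ j≢i → reduced j≢i (proj₂ (leadingOne _))
    }
    where
    open IsRREF rref
    leadingOne : ∀ i → ∃ (LeadingOneAt (X i))
    leadingOne i with zeroOrLeadingOne i
    ... | inj₁ Xi≋0 = contradiction Xi≋0 (noZeroRow X dim i)
    ... | inj₂ lead = lead

  -- If column `j` were no pivot column, every summand of the entry at `j` would vanish: a row with
  -- pivot left of `j` has as coefficient an entry of `x` before its leading one, and a row with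
  -- pivot right of `j` is still zero at `j`.
  leadingOne⇒pivot : {Y : Matrix r n} (ech : Echelon Y) →
    ∀ {x j} → x ∈ Span Y → LeadingOneAt x j → ∃[ i ] Echelon.pivot ech i ≡ j
  leadingOne⇒pivot {Y = Y} ech {x} {j} x∈@(c , x≋) (xj≈1 , x<j)
    with Finₚ.any? (λ i → Echelon.pivot ech i Finₚ.≟ j)
  ... | yes found = found
  ... | no none   = contradiction
    (trans (sym xj≈1) (trans (x≋ j) (sum-zero vanish))) 1≉0
    where
    open Echelon ech
    vanish : ∀ i → c i * Y i j ≈ 0#
    vanish i with Finₚ.<-cmp (pivot i) j
    ... | tri< p<j _ _ = trans
      (*-congʳ (trans (sym (coefficients x∈ i)) (x<j p<j))) (zeroˡ _)
    ... | tri≈ _ p≡j _ = contradiction (i , p≡j) none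
    ... | tri> _ _ j<p = trans (*-congˡ (proj₂ (leading i) j<p)) (zeroʳ _)

  -- Every pivot column of `X` is one of `Y`, since the rows of `X` lie in the span of `Y`. The
  -- induced map `σ` of row indices is strictly increasing, hence never below the identity. Used in
  -- both directions it makes the pivots agree.
  pivot-≤ : {X Y : Matrix r n} (echX : Echelon X) (echY : Echelon Y) →
            Span X ≐ Span Y → ∀ i → Echelon.pivot echY i Fin.≤ Echelon.pivot echX i
  pivot-≤ {r} {X = X} {Y} echX echY (X⊆Y , _) i =
    ≡.subst (Y.pivot i Fin.≤_) (proj₂ (σ-spec i)) (Y-mono-≤ (inflationary i))
    where
    module X = Echelon echX
    module Y = Echelon echY

    σ-spec : ∀ j → ∃[ j′ ] Y.pivot j′ ≡ X.pivot j
    σ-spec j = leadingOne⇒pivot echY (X⊆Y (row∈Span X j)) (X.leading j)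

    σ : Fin r → Fin r
    σ = proj₁ ∘ σ-spec

    Y-mono-≤ : ∀ {j l} → j Fin.≤ l → Y.pivot j Fin.≤ Y.pivot l
    Y-mono-≤ {j} {l} j≤l with Finₚ.<-cmp j l
    ... | tri< j<l _ _    = ℕₚ.<⇒≤ (Y.mono j<l)
    ... | tri≈ _ ≡.refl _ = ℕₚ.≤-refl
    ... | tri> _ _ l<j    = contradiction j≤l (ℕₚ.<⇒≱ l<j)

    σ-mono : ∀ {j l} → j Fin.< l → σ j Fin.< σ l
    σ-mono {j} {l} j<l = ℕₚ.≰⇒> λ σl≤σj → ℕₚ.<⇒≱
      (≡.subst₂ Fin._<_ (≡.sym (proj₂ (σ-spec j))) (≡.sym (proj₂ (σ-spec l)))
        (X.mono j<l))
      (Y-mono-≤ σl≤σj)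

    inflationary : ∀ j → j Fin.≤ σ j
    inflationary = strictlyMonotone⇒inflationary σ σ-mono

  -- The coefficients of `X i` over the rows of `Y` are its entries at the pivots of `Y`. These are
  -- also the pivots of `X`, where `X i` has the entries of a unit vector.
  echelon-unique : {X Y : Matrix r n} → Echelon X → Echelon Y →
                   Span X ≐ Span Y → ∀ i → X i ≋ Y i
  echelon-unique {r} {X = X} {Y} echX echY X≐Y@(X⊆Y , _) i =
    ≋-trans (proj₂ Xi∈) (combination-unit (proj₁ Xi∈) Y i
      (trans (coefficient i) (proj₁ (X.leading i)))
      (λ j j≢i → trans (coefficient j) (X.reduced (j≢i ∘ ≡.sym))))
    where
    module X = Echelon echX
    module Y = Echelon echY

    Xi∈ : X i ∈ Span Y
    Xi∈ = X⊆Y (row∈Span X i)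

    pivot-≡ : ∀ j → Y.pivot j ≡ X.pivot j
    pivot-≡ j = Finₚ.≤-antisym (pivot-≤ echX echY X≐Y j)
                               (pivot-≤ echY echX (≐-sym X≐Y) j)

    coefficient : ∀ j → proj₁ Xi∈ j ≈ X i (X.pivot j)
    coefficient j = trans (sym (Y.coefficients Xi∈ j))
      (reflexive (≡.cong (X i) (pivot-≡ j)))

  -- Gaussian elimination and the existence of τ.

  tailSubspace : Subspace (suc n) → Subspace n
  tailSubspace U = record
    { ⟦_⟧      = λ x → (0# ∷ x) ∈ ⟦ U ⟧
    ; respects = λ x≋y → respects λ { zero → refl ; (suc i) → x≋y i }
    ; 0-closed = respects (λ { zero → refl ; (suc i) → refl }) 0-closed
    ; +-closed = λ x∈ y∈ → respects
        (λ { zero → +-identityʳ 0# ; (suc i) → refl }) (+-closed x∈ y∈)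
    ; *-closed = λ s x∈ → respects
        (λ { zero → zeroʳ s ; (suc i) → refl }) (*-closed s x∈)
    }
    where open Subspace U hiding (⟦_⟧)

  EchelonBasis : Subspace n → Set
  EchelonBasis {n} U = ∃[ r ] ∃[ X ] (Echelon {r} {n} X × Span X ≐ ⟦ U ⟧)

  module _ (U : Subspace (suc n)) {X : Matrix r n} (ech : Echelon X)
           (X≐ : Span X ≐ ⟦ tailSubspace U ⟧) where
    open Subspace U hiding (⟦_⟧)
    open Echelon ech

    private
      shift : Matrix r (suc n)
      shift i = 0# ∷ X i

      shift∈U : ∀ i → shift i ∈ ⟦ U ⟧
      shift∈U i = proj₁ X≐ (row∈Span X i)

      shift-leading : ∀ i → LeadingOneAt (shift i) (suc (pivot i))
      shift-leading i = proj₁ (leading i) , λ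
        { {zero}  _         → refl
        ; {suc j} (s≤s j<p) → proj₂ (leading i) j<p
        }

    extend-zeroColumn : (∀ {x} → x ∈ ⟦ U ⟧ → x zero ≈ 0#) → EchelonBasis U
    extend-zeroColumn head≈0 = r , shift , record
      { pivot   = suc ∘ pivot
      ; leading = shift-leading
      ; mono    = λ i<j → s≤s (mono i<j)
      ; reduced = reduced
      } ,
      (λ (c , x≋) → respects (≋-sym x≋) (combination-closed U c shift shift∈U)) ,
      (λ {x} x∈U →
        let c , tail≋ = proj₂ X≐ (respects
              (λ { zero → head≈0 x∈U ; (suc j) → refl }) x∈U)
        in c , λ
          { zero    → trans (head≈0 x∈U)
                        (sym (combination-zeroʳ c {A = shift} {zero} λ i → refl))
          ; (suc j) → tail≋ j
          })

    -- Clearing the entries of u at the pivots of X makes it the new first row.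
    extend-pivot : ∀ {u} → u ∈ ⟦ U ⟧ → u zero ≈ 1# → EchelonBasis U
    extend-pivot {u} u∈U head≈1 = suc r , Y , record
      { pivot   = zero ∷ (suc ∘ pivot)
      ; leading = λ { zero → top-head , (λ ()) ; (suc i) → shift-leading i }
      ; mono    = λ { {zero} {suc j} _ → s≤s z≤n
                    ; {suc i} {suc j} (s≤s i<j) → s≤s (mono i<j) }
      ; reduced = λ { {zero} {zero} 0≢0 → contradiction ≡.refl 0≢0
                    ; {zero} {suc j} _ → refl
                    ; {suc i} {zero} _ → top-reduced i
                    ; {suc i} {suc j} j≢i → reduced (j≢i ∘ ≡.cong suc) }
      } ,
      (λ (c , x≋) → respects (≋-sym x≋) (combination-closed U c Y
        λ { zero → top∈U ; (suc i) → shift∈U i })) ,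
      (λ {x} x∈U →
        let c , tail≋ = proj₂ X≐ (respects
              (λ { zero → rest-head x ; (suc j) → refl })
              (-‿closed U x∈U (*-closed (x zero) top∈U)))
        in x zero ∷ c , λ
          { zero    → sym (trans (+-cong (trans (*-congˡ top-head) (*-identityʳ _))
                        (combination-zeroʳ c {A = shift} {zero} λ i → refl)) (+-identityʳ _))
          ; (suc j) → sym (trans (+-congˡ (sym (tail≋ j)))
                        (trans (+-comm _ _) (//-rightDividesˡ _ _)))
          })
      where
      correction : Vec n
      correction = combination (λ i → u (suc (pivot i))) X

      top : Vec (suc n)
      top = u -ᵛ (0# ∷ correction)

      Y : Matrix (suc r) (suc n)
      Y = top ∷ shift

      top-head : top zero ≈ 1#
      top-head = trans (x-0≈x _) head≈1

      top-reduced : ∀ i → top (suc (pivot i)) ≈ 0#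
      top-reduced i = trans (+-congˡ (-‿cong (combination-pivot _ i)))
        (-‿inverseʳ _)

      top∈U : top ∈ ⟦ U ⟧
      top∈U = -‿closed U u∈U (proj₁ X≐ (_ , ≋-refl))

      rest-head : ∀ x → x zero - x zero * top zero ≈ 0#
      rest-head x = trans (+-congˡ (-‿cong
        (trans (*-congˡ top-head) (*-identityʳ _)))) (-‿inverseʳ _)

  -- Elimination column by column, starting from the vectors with first entry 0. Whether the first
  -- column gets a pivot is settled by searching `U` for a vector with first entry 1, which is why
  -- membership has to be decidable.
  echelonBasis : (U : Subspace n) → Unary.Decidable ⟦ U ⟧ → EchelonBasis U
  echelonBasis {zero} U U? = 0 , (λ ()) , record
    { pivot   = λ ()
    ; leading = λ ()
    ; mono    = λ { {()} }
    ; reduced = λ { {()} }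
    } , (λ _ → respects (λ ()) 0-closed) , (λ _ → (λ ()) , λ ())
    where open Subspace U hiding (⟦_⟧)
  echelonBasis {suc n} U U?
    with _ , _ , ech , X≐ ← echelonBasis (tailSubspace U) (λ x → U? (0# ∷ x))
    with anyVec? {P = λ x → x ∈ ⟦ U ⟧ × x zero ≈ 1#}
           (λ x≋y (x∈U , head≈1) →
             Subspace.respects U x≋y x∈U , trans (sym (x≋y zero)) head≈1)
           (λ x → U? x ×-dec (x zero ≟ 1#))
  ... | yes (u , u∈U , head≈1) = extend-pivot U ech X≐ u∈U head≈1
  ... | no none                = extend-zeroColumn U ech X≐ head≈0
    where
    head≈0 : ∀ {x} → x ∈ ⟦ U ⟧ → x zero ≈ 0#
    head≈0 {x} x∈U with x zero ≟ 0#
    ... | yes eq = eq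
    -- A nonzero first entry could be rescaled to 1, which `none` excludes.
    ... | no neq with y , xy≈1 ← inverse (x zero) neq = contradiction
      (y *ᵛ x , Subspace.*-closed U y x∈U , trans (*-comm _ _) xy≈1) none

  abstract
    dimension-exists : (U : Subspace n) → Unary.Decidable ⟦ U ⟧ →
                       ∃[ r ] HasDimension ⟦ U ⟧ r
    dimension-exists U U? with r , X , ech , X≐ ← echelonBasis U U? =
      r , HasDimension-cong X≐ (Echelon.dimension ech)

  IsTau⇒Echelon : {U : Subspace n} {X : Matrix k n} → HasDimension ⟦ U ⟧ k →
                  IsTau U X → Echelon X
  IsTau⇒Echelon dimU (rref , X≐U) =
    IsRREF⇒Echelon rref (HasDimension-cong (≐-sym X≐U) dimU)

  abstract
    τ-exists : {U : Subspace n} → HasDimension ⟦ U ⟧ k → ∃[ X ] IsTau {k = k} U X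
    τ-exists {U = U} dimU with r , X , ech , X≐ ← echelonBasis U (∈? dimU)
      with ≡.refl ← dimension-unique X≐ (Echelon.dimension ech) dimU
      = X , Echelon⇒IsRREF ech , X≐

  dimension-zero-unique : {P Q : Pred (Vec v) 0ℓ} →
                          HasDimension P 0 → HasDimension Q 0 → P ≐ Q
  dimension-zero-unique dimP dimQ = ⊆ dimP dimQ , ⊆ dimQ dimP
    where
    ⊆ : {P Q : Pred (Vec v) 0ℓ} → HasDimension P 0 → HasDimension Q 0 →
        ∀ {x} → x ∈ P → x ∈ Q
    ⊆ (_ , _ , _ , P⊆) (_ , _ , ⊆Q , _) x∈P = ⊆Q ((λ ()) , proj₂ (P⊆ x∈P))

  -- Row spaces of concatenated matrices and their intersections.

  module Concatenation (eq : m ℕ.+ n ≡ w) where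
    left : Fin m → Fin w
    left j = Fin.cast eq (j ↑ˡ n)

    right : Fin n → Fin w
    right j = Fin.cast eq (m ↑ʳ j)

    -- The two kinds of codewords split the same `w` columns at different places. Keeping `w` apart
    -- from `m` and `n` lets both splittings act on a single index type.
    columns-elim : (P : Pred (Fin w) p) → (∀ j → P (left j)) →
                   (∀ j → P (right j)) → ∀ j → P j
    columns-elim P l r j = ≡.subst P (Finₚ.cast-involutive eq (≡.sym eq) j)
      (++-elim (P ∘ Fin.cast eq) l r (Fin.cast (≡.sym eq) j))

    append : Vec m → Vec n → Vec w
    append x y j = (x Vector.++ y) (Fin.cast (≡.sym eq) j)

    append-left : ∀ x y j → append x y (left j) ≡ x j
    append-left x y j = ≡.trans
      (≡.cong (x Vector.++ y) (Finₚ.cast-involutive (≡.sym eq) eq (j ↑ˡ n)))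
      (Vectorₚ.lookup-++ˡ x y j)

    append-right : ∀ x y j → append x y (right j) ≡ y j
    append-right x y j = ≡.trans
      (≡.cong (x Vector.++ y) (Finₚ.cast-involutive (≡.sym eq) eq (m ↑ʳ j)))
      (Vectorₚ.lookup-++ʳ x y j)

    infixr 5 _∥_

    _∥_ : Matrix k m → Matrix k n → Matrix k w
    A ∥ B = castColumns eq (A ∣∣ B)

    combination-left : ∀ c (A : Matrix k m) B j →
                       combination c (A ∥ B) (left j) ≈ combination c A j
    combination-left c A B j = sum-cong-≋ λ i →
      *-congˡ (reflexive (append-left (A i) (B i) j))

    combination-right : ∀ c (A : Matrix k m) B j →
                        combination c (A ∥ B) (right j) ≈ combination c B j
    combination-right c A B j = sum-cong-≋ λ i →
      *-congˡ (reflexive (append-right (A i) (B i) j))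

    ∥-cong : {A A′ : Matrix k m} {B B′ : Matrix k n} → (∀ i → A i ≋ A′ i) →
             (∀ i → B i ≋ B′ i) → ∀ i → (A ∥ B) i ≋ (A′ ∥ B′) i
    ∥-cong {A = A} {A′} {B} {B′} A≋ B≋ i = columns-elim _
      (λ j → trans (reflexive (append-left (A i) (B i) j))
        (trans (A≋ i j) (sym (reflexive (append-left (A′ i) (B′ i) j)))))
      (λ j → trans (reflexive (append-right (A i) (B i) j))
        (trans (B≋ i j) (sym (reflexive (append-right (A′ i) (B′ i) j)))))

    ∈Span-∥ : ∀ {x} c {A : Matrix k m} {B} →
              (∀ j → x (left j) ≈ combination c A j) →
              (∀ j → x (right j) ≈ combination c B j) → x ≋ combination c (A ∥ B)
    ∈Span-∥ c {A} {B} l r = columns-elim _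
      (λ j → trans (l j) (sym (combination-left c A B j)))
      (λ j → trans (r j) (sym (combination-right c A B j)))

    Span-left : ∀ {x} {A : Matrix k m} {B} → x ∈ Span (A ∥ B) →
                x ∘ left ∈ Span A
    Span-left {A = A} {B} (c , x≋) =
      c , λ j → trans (x≋ (left j)) (combination-left c A B j)

    Span-right : ∀ {x} {A : Matrix k m} {B} → x ∈ Span (A ∥ B) →
                 x ∘ right ∈ Span B
    Span-right {A = A} {B} (c , x≋) =
      c , λ j → trans (x≋ (right j)) (combination-right c A B j)

    module _ {A : Matrix k m} (indep : LinearlyIndependent A) (B : Matrix k n) where

      ∥-independentˡ : LinearlyIndependent (A ∥ B)
      ∥-independentˡ c c≋0 = indep c λ j →
        trans (sym (combination-left c A B j)) (c≋0 (left j))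

      left-injective : ∀ {x y} → x ∈ Span (A ∥ B) → y ∈ Span (A ∥ B) →
                       x ∘ left ≋ y ∘ left → x ≋ y
      left-injective x∈@(c , x≋) y∈@(e , y≋) x≋y = ≋-trans x≋ (≋-trans
        (combination-congˡ (A ∥ B) (independent-injective indep λ j →
          trans (sym (proj₂ (Span-left x∈) j))
            (trans (x≋y j) (proj₂ (Span-left y∈) j))))
        (≋-sym y≋))

    Span-⊆-left : ∀ {A A′ : Matrix k m} {B B′} →
                  (∀ {x} → x ∈ Span (A ∥ B) → x ∈ Span (A′ ∥ B′)) →
                  ∀ {y} → y ∈ Span A → y ∈ Span A′
    Span-⊆-left {A = A} {B = B} V⊆V′ (c , y≋) =
      let e , eq′ = Span-left (V⊆V′ (c , ≋-refl))
      in e , λ j → trans (y≋ j) (trans (sym (combination-left c A B j)) (eq′ j))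

    Span-⊆-right : ∀ {A A′ : Matrix k m} {B B′} →
                   (∀ {x} → x ∈ Span (A ∥ B) → x ∈ Span (A′ ∥ B′)) →
                   ∀ {y} → y ∈ Span B → y ∈ Span B′
    Span-⊆-right {A = A} {B = B} V⊆V′ (c , y≋) =
      let e , eq′ = Span-right (V⊆V′ (c , ≋-refl))
      in e , λ j → trans (y≋ j) (trans (sym (combination-right c A B j)) (eq′ j))

    ∥-injectiveˡ : ∀ {A A′ : Matrix k m} {B B′} → Echelon A → Echelon A′ →
                   Span (A ∥ B) ≐ Span (A′ ∥ B′) → ∀ i → A i ≋ A′ i
    ∥-injectiveˡ {B = B} {B′} echA echA′ (V⊆V′ , V′⊆V) =
      echelon-unique echA echA′
        (Span-⊆-left {B = B} {B′} V⊆V′ , Span-⊆-left {B = B′} {B} V′⊆V)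

    -- Row `i` of the first matrix is a combination of rows of the second. Its coefficients, read at
    -- the pivots of `A′`, are those of a unit vector because `A` and `A′` agree; so the right
    -- halves of row `i` agree too.
    ∥-injectiveʳ : ∀ {A A′ : Matrix k m} {B B′} → Echelon A → Echelon A′ →
                   Span (A ∥ B) ≐ Span (A′ ∥ B′) → ∀ i → B i ≋ B′ i
    ∥-injectiveʳ {A = A} {A′} {B} {B′} echA echA′ V≐V′@(V⊆V′ , _) i j = begin
      B i j                 ≡⟨ append-right (A i) (B i) j ⟨
      (A ∥ B) i (right j)   ≈⟨ proj₂ row∈ (right j) ⟩
      combination (proj₁ row∈) (A′ ∥ B′) (right j)
                            ≈⟨ combination-right (proj₁ row∈) A′ B′ j ⟩
      combination (proj₁ row∈) B′ j
                            ≈⟨ combination-unit (proj₁ row∈) B′ i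
                                 (trans (coefficient i) (proj₁ (A′.leading i)))
                                 (λ l l≢i → trans (coefficient l)
                                   (A′.reduced (l≢i ∘ ≡.sym))) j ⟩
      B′ i j                ∎
      where
      module A′ = Echelon echA′

      row∈ : (A ∥ B) i ∈ Span (A′ ∥ B′)
      row∈ = V⊆V′ (row∈Span (A ∥ B) i)

      coefficient : ∀ l → proj₁ row∈ l ≈ A′ i (A′.pivot l)
      coefficient l = trans (sym (A′.coefficients (Span-left row∈) l))
        (trans (reflexive (append-left (A i) (B i) _))
          (∥-injectiveˡ echA echA′ V≐V′ i _))

    dimension-∩-left-≤ : ∀ {A A′ : Matrix k m} {B B′} {c c′} →
      LinearlyIndependent A →
      HasDimension (Span (A ∥ B) ∩ Span (A′ ∥ B′)) c →
      HasDimension (Span A ∩ Span A′) c′ → c ℕ.≤ c′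
    dimension-∩-left-≤ {B = B} indep dim dim′ = dimension-mono dim dim′
      (λ {x} _ → x ∘ left)
      (λ (x∈ , x∈′) → Span-left x∈ , Span-left x∈′)
      (λ (x∈ , _) (y∈ , _) → left-injective indep B x∈ y∈)

    dimension-∩-left : ∀ {A A′ : Matrix k m} {c c′} →
      LinearlyIndependent A →
      HasDimension (Span (A ∥ 0ᴹ k n) ∩ Span (A′ ∥ 0ᴹ k n)) c →
      HasDimension (Span A ∩ Span A′) c′ → c ≡ c′
    dimension-∩-left {k = k} indep dim dim′ = ℕₚ.≤-antisym
      (dimension-∩-left-≤ {B = 0ᴹ k n} {0ᴹ k n} indep dim dim′)
      (dimension-mono dim′ dim (λ {x} _ → append x 0ᵛ)
        (λ (x∈ , x∈′) → extend x∈ , extend x∈′)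
        (λ {x} {y} _ _ eq j → trans (sym (reflexive (append-left x 0ᵛ j)))
          (trans (eq (left j)) (reflexive (append-left y 0ᵛ j)))))
      where
      extend : ∀ {x} {A : Matrix k m} → x ∈ Span A →
               append x 0ᵛ ∈ Span (A ∥ 0ᴹ k n)
      extend {x} (c , x≋) = c , ∈Span-∥ c
        (λ j → trans (reflexive (append-left x 0ᵛ j)) (x≋ j))
        (λ j → trans (reflexive (append-right x 0ᵛ j))
          (sym (combination-zeroʳ c {A = 0ᴹ k n} {j} λ i → refl)))

    -- The common vectors of the row spaces of (A | B) and (A | B′) are the
    -- c (A | B) with c (B - B′) = 0.
    dimension-∩-rank : ∀ {A : Matrix k m} {B B′} {c} →
      LinearlyIndependent A →
      HasDimension (Span (A ∥ B) ∩ Span (A ∥ B′)) c →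
      HasRank (B -ᴹ B′) r → r ℕ.+ c ≡ k
    dimension-∩-rank {k = k} {r = r} {A = A} {B} {B′} {c} indep dim rank =
      ≡.trans (≡.cong (r ℕ.+_) c≡s) (rank-nullity (B -ᴹ B′) rank dimK)
      where
      kernel : ∃[ s ] HasDimension ⟦ Kernel (B -ᴹ B′) ⟧ s
      kernel = dimension-exists (Kernel (B -ᴹ B′)) (λ x → _ ≋? _)

      dimK : HasDimension ⟦ Kernel (B -ᴹ B′) ⟧ (proj₁ kernel)
      dimK = proj₂ kernel

      same : ∀ {x} → ((e , _) : x ∈ Span (A ∥ B)) → x ∈ Span (A ∥ B′) →
             e ∈ ⟦ Kernel (B -ᴹ B′) ⟧
      same x∈@(e , _) x∈′@(e′ , _) j = begin
        combination e (B -ᴹ B′) j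
          ≈⟨ combination-minusʳ e B B′ j ⟩
        combination e B j - combination e B′ j
          ≈⟨ -‿cong₂ (sym (proj₂ (Span-right x∈) j))
                     (combination-congˡ B′ e≋e′ j) ⟩
        _ - combination e′ B′ j
          ≈⟨ +-congˡ (-‿cong (proj₂ (Span-right x∈′) j)) ⟨
        _ - _
          ≈⟨ -‿inverseʳ _ ⟩
        0# ∎
        where
        e≋e′ : e ≋ e′
        e≋e′ = independent-injective indep λ l →
          trans (sym (proj₂ (Span-left x∈) l)) (proj₂ (Span-left x∈′) l)

      both : ∀ {e} → e ∈ ⟦ Kernel (B -ᴹ B′) ⟧ →
             combination e (A ∥ B) ∈ Span (A ∥ B′)
      both {e} e∈ = e , ∈Span-∥ e (combination-left e A B)
        (λ j → trans (combination-right e A B j) (x∙y⁻¹≈ε⇒x≈y _ _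
          (trans (sym (combination-minusʳ e B B′ j)) (e∈ j))))

      c≡s : c ≡ proj₁ kernel
      c≡s = ℕₚ.≤-antisym
        (dimension-mono dim dimK
          (λ ((e , _) , _) → e)
          (λ (x∈ , x∈′) → same x∈ x∈′)
          (λ ((_ , x≋) , _) ((_ , y≋) , _) eq → ≋-trans x≋
            (≋-trans (combination-congˡ (A ∥ B) eq) (≋-sym y≋))))
        (dimension-mono dimK dim
          (λ {e} _ → combination e (A ∥ B))
          (λ {e} e∈ → (e , ≋-refl) , both e∈)
          (λ _ _ eq → independent-injective (∥-independentˡ indep B) eq))

    module _ {B : Matrix k n} where

      0∥-left : ∀ {x} → x ∈ Span (0ᴹ k m ∥ B) → ∀ j → x (left j) ≈ 0#
      0∥-left (c , x≋) j = trans (x≋ (left j)) (trans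
        (combination-left c (0ᴹ k m) B j)
        (combination-zeroʳ c {A = 0ᴹ k m} {j} λ i → refl))

      0∥-independent : LinearlyIndependent B → LinearlyIndependent (0ᴹ k m ∥ B)
      0∥-independent indep c c≋0 = indep c λ j →
        trans (sym (combination-right c (0ᴹ k m) B j)) (c≋0 (right j))

      0∥-extend : ∀ {x} → x ∈ Span B → append 0ᵛ x ∈ Span (0ᴹ k m ∥ B)
      0∥-extend {x} (c , x≋) = c , ∈Span-∥ c
        (λ j → trans (reflexive (append-left 0ᵛ x j))
          (sym (combination-zeroʳ c {A = 0ᴹ k m} {j} λ i → refl)))
        (λ j → trans (reflexive (append-right 0ᵛ x j)) (x≋ j))

    dimension-∩-right : ∀ {B B′ : Matrix k n} {c c′} →
      HasDimension (Span (0ᴹ k m ∥ B) ∩ Span (0ᴹ k m ∥ B′)) c →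
      HasDimension (Span B ∩ Span B′) c′ → c ≡ c′
    dimension-∩-right dim dim′ = ℕₚ.≤-antisym
      (dimension-mono dim dim′ (λ {x} _ → x ∘ right)
        (λ (x∈ , x∈′) → Span-right x∈ , Span-right x∈′)
        (λ (x∈ , _) (y∈ , _) eq → columns-elim _
          (λ j → trans (0∥-left x∈ j) (sym (0∥-left y∈ j))) eq))
      (dimension-mono dim′ dim (λ {x} _ → append 0ᵛ x)
        (λ (x∈ , x∈′) → 0∥-extend x∈ , 0∥-extend x∈′)
        (λ {x} {y} _ _ eq j → trans (sym (reflexive (append-right 0ᵛ x j)))
          (trans (eq (right j)) (reflexive (append-right 0ᵛ y j)))))

  -- A common vector vanishes on the first r columns and is determined by its
  -- first m ≤ r + h columns, so only h columns matter.
  dimension-overlap : (eqˡ : m ℕ.+ n ≡ w) (eqʳ : r ℕ.+ v ≡ w) →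
    ∀ {h c} → h ℕ.≤ v → m ℕ.≤ r ℕ.+ h →
    {X : Matrix k m} {M : Matrix k n} {Y : Matrix k v} → LinearlyIndependent X →
    HasDimension (Span (castColumns eqˡ (X ∣∣ M)) ∩
                  Span (castColumns eqʳ (0ᴹ k r ∣∣ Y))) c → c ℕ.≤ h
  dimension-overlap {m = m} {n = n} {r = r} {v = v} eqˡ eqʳ {h} h≤v m≤r+h {M = M} indep dim =
    dimension-≤ dim (λ {x} _ i → x (R.right (Fin.inject≤ i h≤v)))
      λ {x} {y} (x∈ , x∈′) (y∈ , y∈′) eq → L.left-injective indep M x∈ y∈ λ j →
        R.columns-elim (λ i → toℕ i ℕ.< m → x i ≈ y i)
          (λ i _ → trans (R.0∥-left x∈′ i) (sym (R.0∥-left y∈′ i)))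
          (λ i i<m → ≡.subst (λ l → x (R.right l) ≈ y (R.right l))
            (inject i (h-bound i i<m)) (eq _))
          (L.left j) (≡.subst (ℕ._< m) (≡.sym (toℕ-left j)) (Finₚ.toℕ<n j))
    where
    module L = Concatenation {m} {n} eqˡ
    module R = Concatenation {r} {v} eqʳ

    toℕ-left : ∀ j → toℕ (L.left j) ≡ toℕ j
    toℕ-left j = ≡.trans (Finₚ.toℕ-cast eqˡ (j ↑ˡ n)) (Finₚ.toℕ-↑ˡ j n)

    h-bound : ∀ i → toℕ (R.right i) ℕ.< m → toℕ i ℕ.< h
    h-bound i i<m = ℕₚ.+-cancelˡ-< r (toℕ i) h (ℕₚ.<-≤-trans
      (≡.subst (ℕ._< m)
        (≡.trans (Finₚ.toℕ-cast eqʳ (r ↑ʳ i)) (Finₚ.toℕ-↑ʳ r i)) i<m)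
      m≤r+h)

    inject : ∀ i (i<h : toℕ i ℕ.< h) → Fin.inject≤ (Fin.fromℕ< i<h) h≤v ≡ i
    inject i i<h = Finₚ.toℕ-injective
      (≡.trans (Finₚ.toℕ-inject≤ _ h≤v) (Finₚ.toℕ-fromℕ< i<h))

  -- Intersections and the subspace distance.

  infixr 7 _∩ˢ_

  _∩ˢ_ : Subspace v → Subspace v → Subspace v
  U ∩ˢ W = record
    { ⟦_⟧      = ⟦ U ⟧ ∩ ⟦ W ⟧
    ; respects = λ x≋y (x∈U , x∈W) → U.respects x≋y x∈U , W.respects x≋y x∈W
    ; 0-closed = U.0-closed , W.0-closed
    ; +-closed = λ (x∈U , x∈W) (y∈U , y∈W) → U.+-closed x∈U y∈U , W.+-closed x∈W y∈W
    ; *-closed = λ s (x∈U , x∈W) → U.*-closed s x∈U , W.*-closed s x∈W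
    }
    where
    module U = Subspace U
    module W = Subspace W

  ∩-cong : {P P′ Q Q′ : Pred (Vec v) 0ℓ} → P ≐ P′ → Q ≐ Q′ → P ∩ Q ≐ P′ ∩ Q′
  ∩-cong (P⊆ , ⊆P) (Q⊆ , ⊆Q) =
    (λ (x∈P , x∈Q) → P⊆ x∈P , Q⊆ x∈Q) , (λ (x∈P , x∈Q) → ⊆P x∈P , ⊆Q x∈Q)

  abstract
    ∩-dimension : {U W : Subspace v} → HasDimension ⟦ U ⟧ m → HasDimension ⟦ W ⟧ n →
                  ∃[ c ] HasDimension (⟦ U ⟧ ∩ ⟦ W ⟧) c
    ∩-dimension {U = U} {W} dimU dimW =
      dimension-exists (U ∩ˢ W) (λ x → ∈? dimU x ×-dec ∈? dimW x)

  distance-exists : {U W : Subspace v} → HasDimension ⟦ U ⟧ m →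
                    HasDimension ⟦ W ⟧ n → ∃ (SubspaceDistance U W)
  distance-exists {U = U} {W} dimU dimW =
    _ , _ , _ , _ , dimU , dimW , proj₂ (∩-dimension {U = U} {W} dimU dimW) , ≡.refl

  -- For equal arguments this says that the relation `SubspaceDistance` is single-valued.
  distance-cong : {U U′ W W′ : Subspace v} → U ≐ˢ U′ → W ≐ˢ W′ → ∀ {t t′} →
                  SubspaceDistance U W t → SubspaceDistance U′ W′ t′ → t ≡ t′
  distance-cong U≐ W≐ (_ , _ , _ , dimU , dimW , dim∩ , t≡)
                      (_ , _ , _ , dimU′ , dimW′ , dim∩′ , t′≡)
    with ≡.refl ← dimension-unique U≐ dimU dimU′
       | ≡.refl ← dimension-unique W≐ dimW dimW′
       | ≡.refl ← dimension-unique (∩-cong U≐ W≐) dim∩ dim∩′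
    = ≡.trans t≡ (≡.sym t′≡)

  distance-formula : {U W : Subspace v} {t c : ℕ} →
    HasDimension ⟦ U ⟧ k → HasDimension ⟦ W ⟧ k →
    HasDimension (⟦ U ⟧ ∩ ⟦ W ⟧) c → SubspaceDistance U W t → t ≡ k ℕ.+ k ∸ 2 ℕ.* c
  distance-formula {U = U} {W} dimU dimW dim∩ D = distance-cong {U = U} {U} {W} {W}
    ≐-refl ≐-refl D (_ , _ , _ , dimU , dimW , dim∩ , ≡.refl)

-- Least values and the order with infinity.

least : {P : Pred ℕ ℓ} → Unary.Decidable P → P n →
        ∃[ m ] (P m × (∀ {l} → P l → m ℕ.≤ l))
least {n = zero}  P? Pn = zero , Pn , λ _ → z≤n
least {n = suc n} P? Pn with P? 0
... | yes P0 = zero , P0 , λ _ → z≤n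
... | no ¬P0 with m , Pm , m≤ ← least (P? ∘ suc) Pn = suc m , Pm , λ
  { {zero} P0 → contradiction P0 ¬P0 ; {suc l} Pl → s≤s (m≤ Pl) }

open Supremum ℕ._≤_ using (_≤⊤⁺; [_]; ≤⁺-trans; [≤]-injective)

≤∞-trans : ∀ {a b c} → a ≤∞ b → b ≤∞ c → a ≤∞ c
≤∞-trans = ≤⁺-trans ℕₚ.≤-trans

≤∞-refl : ∀ {a} → a ≤∞ a
≤∞-refl {[ _ ]} = [ ℕₚ.≤-refl ]
≤∞-refl {⊤⁺}    = ⊤⁺ ≤⊤⁺

⊓∞-lowerˡ : ∀ a b → a ⊓∞ b ≤∞ a
⊓∞-lowerˡ [ m ] [ n ] = [ ℕₚ.m⊓n≤m m n ]
⊓∞-lowerˡ [ m ] ⊤⁺    = ≤∞-refl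
⊓∞-lowerˡ ⊤⁺    b     = b ≤⊤⁺

⊓∞-lowerʳ : ∀ a b → a ⊓∞ b ≤∞ b
⊓∞-lowerʳ [ m ] [ n ] = [ ℕₚ.m⊓n≤n m n ]
⊓∞-lowerʳ [ m ] ⊤⁺    = [ m ] ≤⊤⁺
⊓∞-lowerʳ ⊤⁺    b     = ≤∞-refl

⊓∞-sel : ∀ a b → a ⊓∞ b ≡ a ⊎ a ⊓∞ b ≡ b
⊓∞-sel [ m ] [ n ] = ⊎.map (≡.cong [_]) (≡.cong [_]) (ℕₚ.⊓-sel m n)
⊓∞-sel [ m ] ⊤⁺    = inj₁ ≡.refl
⊓∞-sel ⊤⁺    b     = inj₂ ≡.refl

a≤b⇒a⊓∞b≡a : ∀ {a b} → a ≤∞ b → a ⊓∞ b ≡ a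
a≤b⇒a⊓∞b≡a {[ m ]} {[ n ]} [ m≤n ] = ≡.cong [_] (ℕₚ.m≤n⇒m⊓n≡m m≤n)
a≤b⇒a⊓∞b≡a {[ m ]} (_ ≤⊤⁺) = ≡.refl
a≤b⇒a⊓∞b≡a {⊤⁺}    (_ ≤⊤⁺) = ≡.refl

2*∞-mono : ∀ {a n} → a ≤∞ [ n ] → 2*∞ a ≤∞ [ 2 ℕ.* n ]
2*∞-mono [ m≤n ] = [ ℕₚ.*-monoʳ-≤ 2 m≤n ]

≤∞-finite : ∀ {a n} → a ≤∞ [ n ] → ∃[ m ] a ≡ [ m ]
≤∞-finite [ _ ] = _ , ≡.refl

2*∞-finite : ∀ {a n} → 2*∞ a ≡ [ n ] → ∃[ m ] (a ≡ [ m ] × n ≡ 2 ℕ.* m)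
2*∞-finite {[ m ]} ≡.refl = m , ≡.refl , ≡.refl

-- Cardinality and minimum distance of codes over a setoid.

module _ (S : Setoid a ℓ) where
  open Setoid S renaming (Carrier to A)

  module _ {C : Pred A p} where

    hasCardinality : {I : Set} → Fin n ↔ I → (f : I → A) → (∀ i → f i ∈ C) →
      (∀ {i j} → f i ≈ f j → i ≡ j) → (∀ {x} → x ∈ C → ∃[ i ] f i ≈ x) →
      HasCardinality S C n
    hasCardinality I↔ f f∈C f-inj f-surj = record
      { to        = λ i → f (to i) , f∈C (to i)
      ; cong      = λ i≡j → reflexive (≡.cong (f ∘ to) i≡j)
      ; bijective =
          (λ eq → ≡.trans (≡.sym (strictlyInverseʳ _))
            (≡.trans (≡.cong from (f-inj eq)) (strictlyInverseʳ _))) ,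
          (λ (x , x∈C) → let i , fi≈x = f-surj x∈C in from i , λ z≡ →
            trans (reflexive (≡.cong f (≡.trans (≡.cong to z≡) (strictlyInverseˡ i)))) fi≈x)
      }
      where open Inverse I↔

    enumerate : HasCardinality S C n → Fin n → A
    enumerate card i = proj₁ (Bijection.to card i)

    enumerate-∈ : (card : HasCardinality S C n) → ∀ i → enumerate card i ∈ C
    enumerate-∈ card i = proj₂ (Bijection.to card i)

    enumerate-injective : (card : HasCardinality S C n) → ∀ {i j} →
                          enumerate card i ≈ enumerate card j → i ≡ j
    enumerate-injective card = Bijection.injective card

    position : (card : HasCardinality S C n) → ∀ {x} → x ∈ C →
               ∃[ i ] enumerate card i ≈ x
    position card x∈C = Bijection.strictlySurjective card (_ , x∈C)

    module _ {D : A → A → ℕ → Set} where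

      minimumDistance-≤ : ∀ d {x y t} → HasMinimumDistance S D C d → x ∈ C → y ∈ C →
                          ¬ x ≈ y → D x y t → d ≤∞ [ t ]
      minimumDistance-≤ [ d ] (d≤ , _) x∈C y∈C x≉y Dxyt = [ d≤ x∈C y∈C x≉y Dxyt ]
      minimumDistance-≤ ⊤⁺ card x∈C y∈C x≉y _
        with position card x∈C | position card y∈C
      ... | zero , z≈x | zero , z≈y = contradiction (trans (sym z≈x) z≈y) x≉y

      inhabited : ∀ d → HasMinimumDistance S D C d → ∃ C
      inhabited [ d ] (_ , x , _ , x∈C , _) = x , x∈C
      inhabited ⊤⁺    card                  = enumerate card zero , enumerate-∈ card zero

      minimumDistance-attained : ∀ d → HasMinimumDistance S D C d → ∀ {t} → d ≡ [ t ] →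
                                 ∃[ x ] ∃[ y ] (x ∈ C × y ∈ C × ¬ x ≈ y × D x y t)
      minimumDistance-attained [ d ] (_ , attained) ≡.refl = attained

      module _ (card : HasCardinality S C n)
               (D-total : ∀ {x y} → x ∈ C → y ∈ C → ∃ (D x y))
               (D-cong : ∀ {x x′ y y′ t t′} → x ≈ x′ → y ≈ y′ →
                         D x y t → D x′ y′ t′ → t ≡ t′) where
        private
          distance : Fin n → Fin n → ℕ
          distance i j = proj₁ (D-total (enumerate-∈ card i) (enumerate-∈ card j))

          Attained : ℕ → Set
          Attained t = ∃[ i ] ∃[ j ] (i ≢ j × distance i j ≡ t)

          attained? : Unary.Decidable Attained
          attained? t = Finₚ.any? λ i → Finₚ.any? λ j →
            ¬? (i Finₚ.≟ j) ×-dec (distance i j ℕₚ.≟ t)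

          realises : ∀ {x y t} → x ∈ C → y ∈ C → ¬ x ≈ y → D x y t → Attained t
          realises x∈C y∈C x≉y Dxyt =
            let i , i≈x = position card x∈C
                j , j≈y = position card y∈C
            in i , j
             , (λ i≡j → x≉y (trans (sym i≈x)
                 (trans (reflexive (≡.cong (enumerate card) i≡j)) j≈y)))
             , D-cong i≈x j≈y (proj₂ (D-total _ _)) Dxyt

        -- Through the enumeration of the code, being attained as a distance becomes a finite,
        -- decidable condition, so a least attained value can be found. `D-cong` is needed because a
        -- codeword is only equivalent to its enumerated copy.
        minimumDistance-exists : ∃[ x ] ∃[ y ] (x ∈ C × y ∈ C × ¬ x ≈ y) →
                                 ∃[ d ] HasMinimumDistance S D C [ d ]
        minimumDistance-exists (x , y , x∈C , y∈C , x≉y)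
          with d , (i , j , i≢j , Dij≡d) , d≤ ← least attained?
            (realises x∈C y∈C x≉y (proj₂ (D-total x∈C y∈C)))
          = d , (λ x∈C y∈C x≉y Dxyt → d≤ (realises x∈C y∈C x≉y Dxyt)) ,
            enumerate card i , enumerate card j ,
            enumerate-∈ card i , enumerate-∈ card j ,
            i≢j ∘ enumerate-injective card ,
            ≡.subst (D _ _) Dij≡d (proj₂ (D-total _ _))

-- Arithmetic of the distance 2k - 2c.

2*-complement : ∀ r n → r ℕ.+ n ≡ k → k ℕ.+ k ∸ 2 ℕ.* n ≡ 2 ℕ.* r
2*-complement r n ≡.refl = ≡.trans
  (≡.cong (_∸ 2 ℕ.* n) (doubled r n)) (ℕₚ.m+n∸n≡m (2 ℕ.* r) (2 ℕ.* n))
  where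
  doubled : ∀ r n → r ℕ.+ n ℕ.+ (r ℕ.+ n) ≡ 2 ℕ.* r ℕ.+ 2 ℕ.* n
  doubled = solve-∀

-- Truncated subtraction gives k ∸ e = k - min(e, k), so an intersection of dimension at most k ∸ e
-- leaves the distance 2 min(e, k), which is min(d, 2k) for d = 2e.
2*[e⊓k]≤2*k∸2*c : ∀ k e {c} → c ℕ.≤ k ∸ e →
                  2 ℕ.* (e ℕ.⊓ k) ℕ.≤ k ℕ.+ k ∸ 2 ℕ.* c
2*[e⊓k]≤2*k∸2*c k e {c} c≤k∸e = begin
  2 ℕ.* (e ℕ.⊓ k)         ≡⟨ 2*-complement (e ℕ.⊓ k) (k ∸ e) (ℕₚ.m⊓n+n∸m≡n e k) ⟨
  k ℕ.+ k ∸ 2 ℕ.* (k ∸ e) ≤⟨ ℕₚ.∸-monoʳ-≤ (k ℕ.+ k) (ℕₚ.*-monoʳ-≤ 2 c≤k∸e) ⟩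
  k ℕ.+ k ∸ 2 ℕ.* c       ∎
  where open ℕₚ.≤-Reasoning

m∸n<m : 0 ℕ.< m → 0 ℕ.< n → m ∸ n ℕ.< m
m∸n<m {suc m} {suc n} _ _ = s≤s (ℕₚ.m∸n≤m m n)

-- The linkage code: dimensions and lower bounds.

module _ {q : ℕ} (F : FiniteField q) where
  open Codes F
  open LinearAlgebra F
  open VecEq (FiniteField.setoid F) using (≋-refl; ≋-sym)

  module Linkage
    {v₁ v₂ k e d N₁ N₂ Nᵣ : ℕ} {d₁ d₂ dᵣ : ℕ∞}
    {C₁ : SubspaceCode v₁} {C₂ : SubspaceCode v₂} {Cᵣ : MatrixCode k (v₂ ∸ k ℕ.+ e)}
    (cdc₁ : IsConstantDimensionCode v₁ N₁ d₁ k C₁)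
    (cdc₂ : IsConstantDimensionCode v₂ N₂ d₂ k C₂)
    (rmc : IsRankMetricCode k (v₂ ∸ k ℕ.+ e) Nᵣ dᵣ Cᵣ) (linear : IsLinear Cᵣ)
    (2e≡d : 2 ℕ.* e ≡ d) (0<d : 0 ℕ.< d)
    (δ≤2k : d₁ ⊓∞ d₂ ⊓∞ 2*∞ dᵣ ⊓∞ [ d ] ≤∞ [ 2 ℕ.* k ])
    where

    private
      module C₁ = IsConstantDimensionCode cdc₁
      module C₂ = IsConstantDimensionCode cdc₂
      module Cᵣ = IsRankMetricCode rmc

      nᵣ z width : ℕ
      nᵣ = v₂ ∸ k ℕ.+ e
      z = v₁ ∸ k ℕ.+ e
      width = v₁ ℕ.+ v₂ ∸ k ℕ.+ e

      code : SubspaceCode width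
      code = linkage C₁.k≤v C₂.k≤v e C₁ C₂ Cᵣ

      S : Setoid _ _
      S = subspaceSetoid width

      module L = Concatenation {v₁} {nᵣ} (leftWidth C₁.k≤v C₂.k≤v e)
      module R = Concatenation {z} {v₂} (rightWidth C₁.k≤v C₂.k≤v e)

      -- `μ` is the share of the three component codes: whenever it is finite, some pair of
      -- codewords attains it. The remaining term of `δ` bounds mixed pairs and comes with no such
      -- pair.
      μ δ : ℕ∞
      μ = d₁ ⊓∞ d₂ ⊓∞ 2*∞ dᵣ
      δ = μ ⊓∞ [ d ]

      δ≤d₁ : δ ≤∞ d₁
      δ≤d₁ = ≤∞-trans (⊓∞-lowerˡ μ [ d ]) (≤∞-trans
        (⊓∞-lowerˡ (d₁ ⊓∞ d₂) (2*∞ dᵣ)) (⊓∞-lowerˡ d₁ d₂))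

      δ≤d₂ : δ ≤∞ d₂
      δ≤d₂ = ≤∞-trans (⊓∞-lowerˡ μ [ d ]) (≤∞-trans
        (⊓∞-lowerˡ (d₁ ⊓∞ d₂) (2*∞ dᵣ)) (⊓∞-lowerʳ d₁ d₂))

      δ≤2dᵣ : δ ≤∞ 2*∞ dᵣ
      δ≤2dᵣ = ≤∞-trans (⊓∞-lowerˡ μ [ d ]) (⊓∞-lowerʳ (d₁ ⊓∞ d₂) (2*∞ dᵣ))

      δ≤2[e⊓k] : δ ≤∞ [ 2 ℕ.* (e ℕ.⊓ k) ]
      δ≤2[e⊓k] with ℕₚ.⊓-sel e k
      ... | inj₁ eq rewrite eq | 2e≡d = ⊓∞-lowerʳ μ [ d ]
      -- Here the dimension, not d, limits the mixed distance.
      ... | inj₂ eq rewrite eq        = δ≤2k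

      0<e : 0 ℕ.< e
      0<e = ℕₚ.n≢0⇒n>0 λ { ≡.refl → ℕₚ.<-irrefl 2e≡d 0<d }

    echelon₁ : ∀ {U X} → U ∈ C₁ → IsTau U X → Echelon X
    echelon₁ {U} U∈ τ = IsTau⇒Echelon {U = U} (C₁.dimension U∈) τ

    echelon₂ : ∀ {W Y} → W ∈ C₂ → IsTau W Y → Echelon Y
    echelon₂ {W} W∈ τ = IsTau⇒Echelon {U = W} (C₂.dimension W∈) τ

    left-dimension : ∀ {X M} → Echelon X → HasDimension (Span (X L.∥ M)) k
    left-dimension {M = M} ech =
      _ , L.∥-independentˡ (Echelon.independent ech) M , ≐-refl

    right-dimension : ∀ {Y} → Echelon Y → HasDimension (Span (0ᴹ k z R.∥ Y)) k
    right-dimension ech = _ , R.0∥-independent (Echelon.independent ech) , ≐-refl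

    dimension-code : ∀ {V} → V ∈ code → HasDimension ⟦ V ⟧ k
    dimension-code (inj₁ (_ , _ , M , U∈ , τ , _ , V≐)) =
      HasDimension-cong (≐-sym V≐) (left-dimension {M = M} (echelon₁ U∈ τ))
    dimension-code (inj₂ (_ , _ , W∈ , τ , V≐)) =
      HasDimension-cong (≐-sym V≐) (right-dimension (echelon₂ W∈ τ))

    -- Of the first v₁ columns, v₁ - k + e lie in the zero block, which leaves at most k ∸ e. For e
    -- > k the truncation is harmless: the zero block covers them all and the intersection is
    -- trivial.
    mixed-dimension : ∀ {X M Y c} → Echelon X →
      HasDimension (Span (X L.∥ M) ∩ Span (0ᴹ k z R.∥ Y)) c → c ℕ.≤ k ∸ e
    mixed-dimension {M = M} ech = dimension-overlap {m = v₁} {nᵣ} {r = z} {v₂}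
      (leftWidth C₁.k≤v C₂.k≤v e) (rightWidth C₁.k≤v C₂.k≤v e)
      (ℕₚ.≤-trans (ℕₚ.m∸n≤m k e) C₂.k≤v)
      (begin
        v₁                       ≡⟨ ℕₚ.m∸n+n≡m C₁.k≤v ⟨
        v₁ ∸ k ℕ.+ k             ≤⟨ ℕₚ.+-monoʳ-≤ (v₁ ∸ k) (ℕₚ.m≤n+m∸n k e) ⟩
        v₁ ∸ k ℕ.+ (e ℕ.+ (k ∸ e)) ≡⟨ ℕₚ.+-assoc (v₁ ∸ k) e (k ∸ e) ⟨
        z ℕ.+ (k ∸ e)            ∎)
      {M = M} (Echelon.independent ech)
      where open ℕₚ.≤-Reasoning

    lowerBound-mixed : ∀ {X M Y c} → Echelon X →
      HasDimension (Span (X L.∥ M) ∩ Span (0ᴹ k z R.∥ Y)) c →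
      δ ≤∞ [ k ℕ.+ k ∸ 2 ℕ.* c ]
    lowerBound-mixed {M = M} ech dim = ≤∞-trans δ≤2[e⊓k]
      [ 2*[e⊓k]≤2*k∸2*c k e (mixed-dimension {M = M} ech dim) ]

    lowerBound-left : ∀ {U U′ X X′ M M′ c} → U ∈ C₁ → U′ ∈ C₁ →
      IsTau U X → IsTau U′ X′ → M ∈ Cᵣ → M′ ∈ Cᵣ →
      ¬ Span (X L.∥ M) ≐ Span (X′ L.∥ M′) →
      HasDimension (Span (X L.∥ M) ∩ Span (X′ L.∥ M′)) c →
      δ ≤∞ [ k ℕ.+ k ∸ 2 ℕ.* c ]
    lowerBound-left {U} {U′} {X} {X′} {M} {M′} {c} U∈ U′∈ τ τ′ M∈ M′∈ V≢V′ dim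
      -- The case split is on the matrices, whose equality is decidable. By uniqueness of the
      -- echelon form, U = U′ would force X = X′.
      with Finₚ.all? (λ i → X i ≋? X′ i)
    ... | no X≢X′ = ≤∞-trans δ≤d₁ (≤∞-trans
      (minimumDistance-≤ (subspaceSetoid v₁) d₁ C₁.minimumDistance U∈ U′∈
        (λ U≐U′ → X≢X′ (echelon-unique (echelon₁ U∈ τ) (echelon₁ U′∈ τ′)
          (≐-trans (proj₂ τ) (≐-trans U≐U′ (≐-sym (proj₂ τ′))))))
        (k , k , _ , C₁.dimension U∈ , C₁.dimension U′∈ , proj₂ dim∩ , ≡.refl))
      [ ℕₚ.∸-monoʳ-≤ (k ℕ.+ k) (ℕₚ.*-monoʳ-≤ 2
          (L.dimension-∩-left-≤ {B = M} {M′}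
            (Echelon.independent (echelon₁ U∈ τ)) dim
            (HasDimension-cong (∩-cong (≐-sym (proj₂ τ)) (≐-sym (proj₂ τ′)))
              (proj₂ dim∩)))) ])
      where
      dim∩ : ∃[ c′ ] HasDimension (⟦ U ⟧ ∩ ⟦ U′ ⟧) c′
      dim∩ = ∩-dimension {U = U} {U′} (C₁.dimension U∈) (C₁.dimension U′∈)
    ... | yes X≋X′ = ≤∞-trans δ≤2dᵣ (≡.subst (2*∞ dᵣ ≤∞_)
      (≡.cong [_] (≡.sym (2*-complement (proj₁ rank) c
        (L.dimension-∩-rank {B = M} {M′} (Echelon.independent (echelon₁ U∈ τ))
          (HasDimension-cong (∩-cong ≐-refl (Span-cong
            (L.∥-cong (≋-sym ∘ X≋X′) (λ _ → ≋-refl)))) dim)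
          (proj₂ rank)))))
      (2*∞-mono (minimumDistance-≤ (matrixSetoid k nᵣ) dᵣ Cᵣ.minimumDistance M∈ M′∈
        (λ M≋M′ → V≢V′ (Span-cong (L.∥-cong X≋X′ M≋M′))) (proj₂ rank))))
      where
      rank : ∃ (HasRank (M -ᴹ M′))
      rank = dimension-exists (rowSpace (M -ᴹ M′)) (Span? (M -ᴹ M′))

    lowerBound-right : ∀ {W W′ Y Y′ c} → W ∈ C₂ → W′ ∈ C₂ →
      IsTau W Y → IsTau W′ Y′ →
      ¬ Span (0ᴹ k z R.∥ Y) ≐ Span (0ᴹ k z R.∥ Y′) →
      HasDimension (Span (0ᴹ k z R.∥ Y) ∩ Span (0ᴹ k z R.∥ Y′)) c →
      δ ≤∞ [ k ℕ.+ k ∸ 2 ℕ.* c ]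
    lowerBound-right {W} {W′} {Y} {Y′} {c} W∈ W′∈ τ τ′ V≢V′ dim = ≤∞-trans δ≤d₂
      (minimumDistance-≤ (subspaceSetoid v₂) d₂ C₂.minimumDistance W∈ W′∈
        (λ W≐W′ → V≢V′ (Span-cong (R.∥-cong (λ _ → ≋-refl)
          (echelon-unique (echelon₂ W∈ τ) (echelon₂ W′∈ τ′)
          (≐-trans (proj₂ τ) (≐-trans W≐W′ (≐-sym (proj₂ τ′))))))))
        (k , k , proj₁ dim∩ , C₂.dimension W∈ , C₂.dimension W′∈ , proj₂ dim∩ ,
          ≡.cong (λ c → k ℕ.+ k ∸ 2 ℕ.* c) (R.dimension-∩-right dim
            (HasDimension-cong (∩-cong (≐-sym (proj₂ τ)) (≐-sym (proj₂ τ′)))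
              (proj₂ dim∩)))))
      where
      dim∩ : ∃[ c′ ] HasDimension (⟦ W ⟧ ∩ ⟦ W′ ⟧) c′
      dim∩ = ∩-dimension {U = W} {W′} (C₂.dimension W∈) (C₂.dimension W′∈)

    lowerBound : ∀ {V V′ t} → V ∈ code → V′ ∈ code → ¬ V ≐ˢ V′ →
                 SubspaceDistance V V′ t → δ ≤∞ [ t ]
    lowerBound {V} {V′} V∈ V′∈ V≢V′ D@(_ , _ , _ , _ , _ , dim∩ , _)
      with ≡.refl ← distance-formula {U = V} {V′}
        (dimension-code {V} V∈) (dimension-code {V′} V′∈) dim∩ D
      with V∈ | V′∈
    ... | inj₁ (_ , _ , M , U∈ , τ , M∈ , V≐) | inj₁ (_ , _ , M′ , U′∈ , τ′ , M′∈ , V′≐) =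
      lowerBound-left U∈ U′∈ τ τ′ M∈ M′∈
        (λ eq → V≢V′ (≐-trans V≐ (≐-trans eq (≐-sym V′≐))))
        (HasDimension-cong (∩-cong V≐ V′≐) dim∩)
    ... | inj₁ (_ , _ , M , U∈ , τ , _ , V≐) | inj₂ (_ , _ , _ , _ , V′≐) =
      lowerBound-mixed {M = M} (echelon₁ U∈ τ) (HasDimension-cong (∩-cong V≐ V′≐) dim∩)
    ... | inj₂ (_ , _ , _ , _ , V≐) | inj₁ (_ , _ , M , U∈ , τ , _ , V′≐) =
      lowerBound-mixed {M = M} (echelon₁ U∈ τ)
        (HasDimension-cong (≐-trans (∩-comm _ _) (∩-cong V′≐ V≐)) dim∩)
    ... | inj₂ (_ , _ , W∈ , τ , V≐) | inj₂ (_ , _ , W′∈ , τ′ , V′≐) =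
      lowerBound-right W∈ W′∈ τ τ′
        (λ eq → V≢V′ (≐-trans V≐ (≐-trans eq (≐-sym V′≐))))
        (HasDimension-cong (∩-cong V≐ V′≐) dim∩)

    -- Pairs of codewords that bound the minimum distance from above.

    DistinctPair : ℕ → Set₁
    DistinctPair t = ∃[ V ] ∃[ V′ ]
      (V ∈ code × V′ ∈ code × ¬ V ≐ˢ V′ × SubspaceDistance V V′ t)

    left∈ : ∀ {U X M} → U ∈ C₁ → IsTau U X → M ∈ Cᵣ → rowSpace (X L.∥ M) ∈ code
    left∈ U∈ τ M∈ = inj₁ (_ , _ , _ , U∈ , τ , M∈ , ≐-refl)

    right∈ : ∀ {W Y} → W ∈ C₂ → IsTau W Y → rowSpace (0ᴹ k z R.∥ Y) ∈ code
    right∈ W∈ τ = inj₂ (_ , _ , W∈ , τ , ≐-refl)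

    left-determines : ∀ {U U′ X X′ M M′} → IsTau U X → IsTau {k = k} U′ X′ →
             Span (X L.∥ M) ≐ Span (X′ L.∥ M′) → U ≐ˢ U′
    left-determines {M = M} {M′} τ τ′ (V⊆V′ , V′⊆V) = ≐-trans (≐-sym (proj₂ τ)) (≐-trans
      (L.Span-⊆-left {B = M} {M′} V⊆V′ , L.Span-⊆-left {B = M′} {M} V′⊆V) (proj₂ τ′))

    right-determines : ∀ {W W′ Y Y′} → IsTau W Y → IsTau {k = k} W′ Y′ →
              Span (0ᴹ k z R.∥ Y) ≐ Span (0ᴹ k z R.∥ Y′) → W ≐ˢ W′
    right-determines τ τ′ (V⊆V′ , V′⊆V) = ≐-trans (≐-sym (proj₂ τ)) (≐-trans
      (R.Span-⊆-right {A = 0ᴹ k z} {0ᴹ k z} V⊆V′ ,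
       R.Span-⊆-right {A = 0ᴹ k z} {0ᴹ k z} V′⊆V) (proj₂ τ′))

    makeDistinctPair : ∀ {t t′ c} (A B : Matrix k width) →
      rowSpace A ∈ code → rowSpace B ∈ code → ¬ Span A ≐ Span B →
      HasDimension (Span A) k → HasDimension (Span B) k →
      HasDimension (Span A ∩ Span B) c →
      t′ ≡ k ℕ.+ k ∸ 2 ℕ.* c → t ≡ t′ → DistinctPair t
    makeDistinctPair A B A∈ B∈ A≢B dimA dimB dim t′≡ t≡t′ =
      rowSpace A , rowSpace B , A∈ , B∈ , A≢B , _ , _ , _ , dimA , dimB , dim , ≡.trans t≡t′ t′≡

    distinctPair-left : ∀ {U U′ X X′ t c c′} → U ∈ C₁ → U′ ∈ C₁ →
      IsTau U X → IsTau U′ X′ → ¬ U ≐ˢ U′ → SubspaceDistance U U′ t →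
      HasDimension (Span (X L.∥ 0ᴹ k nᵣ) ∩ Span (X′ L.∥ 0ᴹ k nᵣ)) c →
      HasDimension (⟦ U ⟧ ∩ ⟦ U′ ⟧) c′ → DistinctPair t
    distinctPair-left {U} {U′} {X} {X′} {c = c} {c′} U∈ U′∈ τ τ′ U≢U′ D dim dim′ =
      makeDistinctPair (X L.∥ 0ᴹ k nᵣ) (X′ L.∥ 0ᴹ k nᵣ)
        (left∈ U∈ τ 0∈) (left∈ U′∈ τ′ 0∈)
        (λ eq → U≢U′ (left-determines {U} {U′} {M = 0ᴹ k nᵣ} {0ᴹ k nᵣ} τ τ′ eq))
        (left-dimension {M = 0ᴹ k nᵣ} (echelon₁ U∈ τ))
        (left-dimension {M = 0ᴹ k nᵣ} (echelon₁ U′∈ τ′))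
        dim (≡.cong (λ c → k ℕ.+ k ∸ 2 ℕ.* c) (≡.sym c≡c′))
        (distance-formula {U = U} {U′} (C₁.dimension U∈) (C₁.dimension U′∈) dim′ D)
      where
      0∈ : 0ᴹ k nᵣ ∈ Cᵣ
      0∈ = IsLinear.0-closed linear

      c≡c′ : c ≡ c′
      c≡c′ = L.dimension-∩-left (Echelon.independent (echelon₁ U∈ τ)) dim
        (HasDimension-cong (∩-cong (≐-sym (proj₂ τ)) (≐-sym (proj₂ τ′))) dim′)

    distinctPair-right : ∀ {W W′ Y Y′ t c c′} → W ∈ C₂ → W′ ∈ C₂ →
      IsTau W Y → IsTau W′ Y′ → ¬ W ≐ˢ W′ → SubspaceDistance W W′ t →
      HasDimension (Span (0ᴹ k z R.∥ Y) ∩ Span (0ᴹ k z R.∥ Y′)) c →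
      HasDimension (⟦ W ⟧ ∩ ⟦ W′ ⟧) c′ → DistinctPair t
    distinctPair-right {W} {W′} {Y} {Y′} {c = c} {c′} W∈ W′∈ τ τ′ W≢W′ D dim dim′ =
      makeDistinctPair (0ᴹ k z R.∥ Y) (0ᴹ k z R.∥ Y′)
        (right∈ W∈ τ) (right∈ W′∈ τ′)
        (λ eq → W≢W′ (right-determines {W} {W′} τ τ′ eq))
        (right-dimension (echelon₂ W∈ τ)) (right-dimension (echelon₂ W′∈ τ′))
        dim (≡.cong (λ c → k ℕ.+ k ∸ 2 ℕ.* c) (≡.sym c≡c′))
        (distance-formula {U = W} {W′} (C₂.dimension W∈) (C₂.dimension W′∈) dim′ D)
      where
      c≡c′ : c ≡ c′
      c≡c′ = R.dimension-∩-right dim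
        (HasDimension-cong (∩-cong (≐-sym (proj₂ τ)) (≐-sym (proj₂ τ′))) dim′)

    distinctPair-rank : ∀ {U X M M′ t c} → U ∈ C₁ → IsTau U X → M ∈ Cᵣ → M′ ∈ Cᵣ →
      ¬ (Setoid._≈_ (matrixSetoid k nᵣ) M M′) → RankDistance M M′ t →
      HasDimension (Span (X L.∥ M) ∩ Span (X L.∥ M′)) c → DistinctPair (2 ℕ.* t)
    distinctPair-rank {X = X} {M} {M′} {t} {c} U∈ τ M∈ M′∈ M≢M′ rank dim =
      makeDistinctPair (X L.∥ M) (X L.∥ M′) (left∈ U∈ τ M∈) (left∈ U∈ τ M′∈)
        (λ eq → M≢M′ (L.∥-injectiveʳ ech ech eq))
        (left-dimension {M = M} ech) (left-dimension {M = M′} ech)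
        dim (≡.sym (2*-complement t c
          (L.dimension-∩-rank {B = M} {M′} (Echelon.independent ech) dim rank)))
        ≡.refl
      where ech = echelon₁ U∈ τ

    distinctPair₁ : ∀ {t} → d₁ ≡ [ t ] → DistinctPair t
    distinctPair₁ {t} eq =
      from (minimumDistance-attained (subspaceSetoid v₁) d₁ C₁.minimumDistance eq)
      where
      from′ : ∀ {U U′} (U∈ : U ∈ C₁) (U′∈ : U′ ∈ C₁) → ¬ U ≐ˢ U′ →
              SubspaceDistance U U′ t → ∃ (IsTau {k = k} U) → ∃ (IsTau {k = k} U′) →
              DistinctPair t
      from′ {U} {U′} U∈ U′∈ U≢U′ D (X , τ) (X′ , τ′) =
        distinctPair-left U∈ U′∈ τ τ′ U≢U′ D
          (proj₂ (∩-dimension {U = rowSpace (X L.∥ 0ᴹ k nᵣ)} {rowSpace (X′ L.∥ 0ᴹ k nᵣ)}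
            (left-dimension {M = 0ᴹ k nᵣ} (echelon₁ U∈ τ))
            (left-dimension {M = 0ᴹ k nᵣ} (echelon₁ U′∈ τ′))))
          (proj₂ (∩-dimension {U = U} {U′} (C₁.dimension U∈) (C₁.dimension U′∈)))

      from : ∃[ U ] ∃[ U′ ] (U ∈ C₁ × U′ ∈ C₁ × ¬ U ≐ˢ U′ × SubspaceDistance U U′ t) →
             DistinctPair t
      from (U , U′ , U∈ , U′∈ , U≢U′ , D) = from′ U∈ U′∈ U≢U′ D
        (τ-exists {U = U} (C₁.dimension U∈)) (τ-exists {U = U′} (C₁.dimension U′∈))

    distinctPair₂ : ∀ {t} → d₂ ≡ [ t ] → DistinctPair t
    distinctPair₂ {t} eq =
      from (minimumDistance-attained (subspaceSetoid v₂) d₂ C₂.minimumDistance eq)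
      where
      from′ : ∀ {W W′} (W∈ : W ∈ C₂) (W′∈ : W′ ∈ C₂) → ¬ W ≐ˢ W′ →
              SubspaceDistance W W′ t → ∃ (IsTau {k = k} W) → ∃ (IsTau {k = k} W′) →
              DistinctPair t
      from′ {W} {W′} W∈ W′∈ W≢W′ D (Y , τ) (Y′ , τ′) =
        distinctPair-right W∈ W′∈ τ τ′ W≢W′ D
          (proj₂ (∩-dimension {U = rowSpace (0ᴹ k z R.∥ Y)} {rowSpace (0ᴹ k z R.∥ Y′)}
            (right-dimension (echelon₂ W∈ τ)) (right-dimension (echelon₂ W′∈ τ′))))
          (proj₂ (∩-dimension {U = W} {W′} (C₂.dimension W∈) (C₂.dimension W′∈)))

      from : ∃[ W ] ∃[ W′ ] (W ∈ C₂ × W′ ∈ C₂ × ¬ W ≐ˢ W′ × SubspaceDistance W W′ t) →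
             DistinctPair t
      from (W , W′ , W∈ , W′∈ , W≢W′ , D) = from′ W∈ W′∈ W≢W′ D
        (τ-exists {U = W} (C₂.dimension W∈)) (τ-exists {U = W′} (C₂.dimension W′∈))

    -- Any codeword of `C₁` serves as the common left block. One exists because even the minimum
    -- distance ∞ presupposes a codeword.
    distinctPairᵣ : ∀ {t} → dᵣ ≡ [ t ] → DistinctPair (2 ℕ.* t)
    distinctPairᵣ {t} eq =
      from (minimumDistance-attained (matrixSetoid k nᵣ) dᵣ Cᵣ.minimumDistance eq)
        (inhabited (subspaceSetoid v₁) d₁ C₁.minimumDistance)
      where
      from′ : ∀ {M M′ U} → M ∈ Cᵣ → M′ ∈ Cᵣ → ¬ Setoid._≈_ (matrixSetoid k nᵣ) M M′ →
              RankDistance M M′ t → U ∈ C₁ → ∃ (IsTau {k = k} U) → DistinctPair (2 ℕ.* t)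
      from′ {M} {M′} M∈ M′∈ M≢M′ rank U∈ (X , τ) =
        distinctPair-rank U∈ τ M∈ M′∈ M≢M′ rank
          (proj₂ (∩-dimension {U = rowSpace (X L.∥ M)} {rowSpace (X L.∥ M′)}
            (left-dimension {M = M} (echelon₁ U∈ τ))
            (left-dimension {M = M′} (echelon₁ U∈ τ))))

      from : ∃[ M ] ∃[ M′ ] (M ∈ Cᵣ × M′ ∈ Cᵣ ×
               ¬ Setoid._≈_ (matrixSetoid k nᵣ) M M′ × RankDistance M M′ t) →
             ∃ C₁ → DistinctPair (2 ℕ.* t)
      from (_ , _ , M∈ , M′∈ , M≢M′ , rank) (U , U∈) =
        from′ M∈ M′∈ M≢M′ rank U∈ (τ-exists {U = U} (C₁.dimension U∈))

    -- A minimum is one of its arguments, so the pair comes from whichever component code realises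
    -- it.
    distinctPair-μ : ∀ {t} → μ ≡ [ t ] → DistinctPair t
    distinctPair-μ eq with ⊓∞-sel (d₁ ⊓∞ d₂) (2*∞ dᵣ)
    ... | inj₂ μ≡2dᵣ with _ , dᵣ≡ , ≡.refl ← 2*∞-finite (≡.trans (≡.sym μ≡2dᵣ) eq)
                     = distinctPairᵣ dᵣ≡
    ... | inj₁ μ≡ with ⊓∞-sel d₁ d₂
    ...   | inj₁ ≡d₁ = distinctPair₁ (≡.trans (≡.sym ≡d₁) (≡.trans (≡.sym μ≡) eq))
    ...   | inj₂ ≡d₂ = distinctPair₂ (≡.trans (≡.sym ≡d₂) (≡.trans (≡.sym μ≡) eq))

    -- For k = 0 there are no two distinct codewords, so δ = d > 0 = 2k.
    0<k : 0 ℕ.< k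
    0<k = ℕₚ.n≢0⇒n>0 λ k≡0 → absurd k≡0 (⊓∞-sel μ [ d ])
      where
      absurd : k ≡ 0 → ¬ (δ ≡ μ ⊎ δ ≡ [ d ])
      absurd k≡0 (inj₁ δ≡μ)
        with _ , μ≡t ← ≤∞-finite (≡.subst (_≤∞ _) δ≡μ δ≤2k)
        with V , V′ , V∈ , V′∈ , V≢V′ , _ ← distinctPair-μ μ≡t
        = V≢V′ (dimension-zero-unique
            (≡.subst (HasDimension ⟦ V ⟧) k≡0 (dimension-code {V} V∈))
            (≡.subst (HasDimension ⟦ V′ ⟧) k≡0 (dimension-code {V′} V′∈)))
      absurd k≡0 (inj₂ δ≡d) = ℕₚ.<⇒≱ 0<d (≡.subst (λ k → d ℕ.≤ 2 ℕ.* k) k≡0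
        ([≤]-injective (≡.subst (_≤∞ _) δ≡d δ≤2k)))

    -- Equal row spaces would meet in dimension k, but the intersection has dimension at most k ∸ e,
    -- which is smaller than k because both k and e are positive. Hence the two families of
    -- codewords are disjoint.
    left≢right : ∀ {X M Y} → Echelon X → ¬ Span (X L.∥ M) ≐ Span (0ᴹ k z R.∥ Y)
    left≢right {M = M} ech (V⊆V′ , _) = ℕₚ.<⇒≱ (m∸n<m 0<k 0<e)
      (mixed-dimension {M = M} ech
        (HasDimension-cong ((λ x∈ → x∈ , V⊆V′ x∈) , proj₁) (left-dimension {M = M} ech)))

    -- The number of codewords.

    private
      Index : Set
      Index = (Fin N₁ × Fin Nᵣ) ⊎ Fin N₂

      S₁ : Setoid _ _
      S₁ = subspaceSetoid v₁

      S₂ : Setoid _ _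
      S₂ = subspaceSetoid v₂

      Sᵣ : Setoid _ _
      Sᵣ = matrixSetoid k nᵣ

      U : Fin N₁ → Subspace v₁
      U = enumerate S₁ C₁.cardinality

      U∈ : ∀ i → U i ∈ C₁
      U∈ = enumerate-∈ S₁ C₁.cardinality

      W : Fin N₂ → Subspace v₂
      W = enumerate S₂ C₂.cardinality

      W∈ : ∀ i → W i ∈ C₂
      W∈ = enumerate-∈ S₂ C₂.cardinality

      M : Fin Nᵣ → Matrix k nᵣ
      M = enumerate Sᵣ Cᵣ.cardinality

      τU : ∀ i → ∃ (IsTau (U i))
      τU i = τ-exists {U = U i} (C₁.dimension (U∈ i))

      τW : ∀ i → ∃ (IsTau (W i))
      τW i = τ-exists {U = W i} (C₂.dimension (W∈ i))

      X : Fin N₁ → Matrix k v₁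
      X i = proj₁ (τU i)

      Y : Fin N₂ → Matrix k v₂
      Y i = proj₁ (τW i)

      family : Index → Subspace width
      family (inj₁ (i , j)) = rowSpace (X i L.∥ M j)
      family (inj₂ i)       = rowSpace (0ᴹ k z R.∥ Y i)

      family∈ : ∀ i → family i ∈ code
      family∈ (inj₁ (i , j)) = inj₁ (U i , X i , M j , U∈ i , proj₂ (τU i) ,
        enumerate-∈ Sᵣ Cᵣ.cardinality j , ≐-refl)
      family∈ (inj₂ i)       = inj₂ (W i , Y i , W∈ i , proj₂ (τW i) , ≐-refl)

      echelonX : ∀ i → Echelon (X i)
      echelonX i = echelon₁ (U∈ i) (proj₂ (τU i))

      family-injective : ∀ i j → family i ≐ˢ family j → i ≡ j
      family-injective (inj₁ (i , j)) (inj₁ (i′ , j′)) V≐V′ =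
        ≡.cong₂ (λ i j → inj₁ (i , j))
          (enumerate-injective S₁ C₁.cardinality
            (left-determines {U i} {U i′} {M = M j} {M j′}
              (proj₂ (τU i)) (proj₂ (τU i′)) V≐V′))
          (enumerate-injective Sᵣ Cᵣ.cardinality
            (L.∥-injectiveʳ (echelonX i) (echelonX i′) V≐V′))
      family-injective (inj₁ (i , j)) (inj₂ i′) V≐V′ =
        contradiction V≐V′ (left≢right {M = M j} (echelonX i))
      family-injective (inj₂ i) (inj₁ (i′ , j′)) V≐V′ =
        contradiction (≐-sym V≐V′) (left≢right {M = M j′} (echelonX i′))
      family-injective (inj₂ i) (inj₂ i′) V≐V′ = ≡.cong inj₂
        (enumerate-injective S₂ C₂.cardinality
          (right-determines {W i} {W i′} (proj₂ (τW i)) (proj₂ (τW i′)) V≐V′))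

      -- A codeword may come with another representative of its subspace and another copy of its
      -- reduced form than those chosen in the enumeration; uniqueness of the echelon form
      -- identifies them entry by entry.
      family-surjective : ∀ {V} → V ∈ code → ∃[ i ] family i ≐ˢ V
      family-surjective (inj₁ (_ , _ , _ , U′∈ , τ , M′∈ , V≐)) =
        let i , Ui≐ = position S₁ C₁.cardinality U′∈
            j , Mj≋ = position Sᵣ Cᵣ.cardinality M′∈
        in inj₁ (i , j) , ≐-trans (Span-cong (L.∥-cong
             (echelon-unique (echelonX i) (echelon₁ U′∈ τ)
               (≐-trans (proj₂ (proj₂ (τU i))) (≐-trans Ui≐ (≐-sym (proj₂ τ)))))
             Mj≋)) (≐-sym V≐)
      family-surjective (inj₂ (_ , _ , W′∈ , τ , V≐)) =
        let i , Wi≐ = position S₂ C₂.cardinality W′∈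
        in inj₂ i , ≐-trans (Span-cong (R.∥-cong (λ _ → ≋-refl)
             (echelon-unique (echelon₂ (W∈ i) (proj₂ (τW i))) (echelon₂ W′∈ τ)
               (≐-trans (proj₂ (proj₂ (τW i))) (≐-trans Wi≐ (≐-sym (proj₂ τ)))))))
             (≐-sym V≐)

    cardinality : HasCardinality S code (N₁ ℕ.* Nᵣ ℕ.+ N₂)
    cardinality = hasCardinality S
      (↔-trans Finₚ.+↔⊎ (Finₚ.*↔× ⊎-↔ ↔-refl))
      family family∈ (λ {i} {j} → family-injective i j)
      (λ {V} → family-surjective {V})

    -- One codeword of each kind suffices, so the linkage code has a finite minimum distance even
    -- when all three component distances are ∞.
    distinctCodewords : ∃[ V ] ∃[ V′ ] (V ∈ code × V′ ∈ code × ¬ V ≐ˢ V′)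
    distinctCodewords = from (inhabited S₁ d₁ C₁.minimumDistance)
                             (inhabited S₂ d₂ C₂.minimumDistance)
      where
      from′ : ∀ {U W} → U ∈ C₁ → W ∈ C₂ → ∃ (IsTau {k = k} U) → ∃ (IsTau {k = k} W) →
              ∃[ V ] ∃[ V′ ] (V ∈ code × V′ ∈ code × ¬ V ≐ˢ V′)
      from′ U∈ W∈ (X , τ) (Y , τ′) =
        rowSpace (X L.∥ 0ᴹ k nᵣ) , rowSpace (0ᴹ k z R.∥ Y) ,
        left∈ U∈ τ (IsLinear.0-closed linear) , right∈ W∈ τ′ ,
        left≢right {M = 0ᴹ k nᵣ} (echelon₁ U∈ τ)

      from : ∃ C₁ → ∃ C₂ → ∃[ V ] ∃[ V′ ] (V ∈ code × V′ ∈ code × ¬ V ≐ˢ V′)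
      from (U , U∈) (W , W∈) = from′ U∈ W∈
        (τ-exists {U = U} (C₁.dimension U∈)) (τ-exists {U = W} (C₂.dimension W∈))

    -- `d′` is found by search as the least distance that occurs, and the lower bound for all pairs
    -- holds in particular for the pair attaining it. Only for μ ≤ d is there a pair at distance `δ`
    -- to force equality.
    linkage-isCode : ∃[ d′ ]
      ( IsConstantDimensionCode width (N₁ ℕ.* Nᵣ ℕ.+ N₂) d′ k code
      × δ ≤∞ d′ × (μ ≤∞ [ d ] → d′ ≡ δ) )
    linkage-isCode = from (minimumDistance-exists S cardinality
      (λ {V} {V′} V∈ V′∈ →
        distance-exists {U = V} {V′} (dimension-code {V} V∈) (dimension-code {V′} V′∈))
      (λ {U} {U′} {W} {W′} U≐U′ W≐W′ D D′ →
        distance-cong {U = U} {U′} {W} {W′} U≐U′ W≐W′ D D′)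
      distinctCodewords)
      where
      from : ∃[ d′ ] HasMinimumDistance S SubspaceDistance code [ d′ ] → _
      from (d′ , min@(d′≤ , V , V′ , V∈ , V′∈ , V≢V′ , D)) = [ d′ ] , record
        { k≤v             = ℕₚ.≤-trans C₁.k≤v (≡.subst (v₁ ℕ.≤_)
                              (leftWidth C₁.k≤v C₂.k≤v e) (ℕₚ.m≤m+n v₁ nᵣ))
        ; cardinality     = cardinality
        ; dimension       = λ {V} → dimension-code {V}
        ; minimumDistance = min
        } , δ≤d′ , attains
        where
        δ≤d′ : δ ≤∞ [ d′ ]
        δ≤d′ = lowerBound {V} {V′} V∈ V′∈ V≢V′ D

        upper : ∀ {t} → DistinctPair t → d′ ℕ.≤ t
        upper (V , V′ , V∈ , V′∈ , V≢V′ , D) = d′≤ {V} {V′} V∈ V′∈ V≢V′ D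

        attains : μ ≤∞ [ d ] → [ d′ ] ≡ δ
        attains μ≤d =
          -- Being at most d makes `μ` finite and equal to `δ`, so its attaining pair bounds `d′`
          -- from above.
          let _ , μ≡t = ≤∞-finite μ≤d
              δ≡t = ≡.trans (a≤b⇒a⊓∞b≡a μ≤d) μ≡t
          in ≡.trans
            (≡.cong [_] (ℕₚ.≤-antisym (upper (distinctPair-μ μ≡t))
              ([≤]-injective (≡.subst (_≤∞ [ d′ ]) δ≡t δ≤d′))))
            (≡.sym δ≡t)

open import Data.Nat.Base using (_+_; _*_; _<_)
open import Data.Nat.Divisibility using (_∣_)
open import Data.Nat.DivMod using (_/_; m*[n/m]≡n)

theorem18 :
  ∀ {q : ℕ} → PrimePower q → (F : FiniteField q) →
  let open Codes F in
  ∀ {v₁ v₂ k N₁ N₂ Nᵣ : ℕ} {d₁ d₂ dᵣ : ℕ∞} {d : ℕ} → 2 ∣ d →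
  {C₁ : SubspaceCode v₁} {C₂ : SubspaceCode v₂} {Cᵣ : MatrixCode k (v₂ ∸ k + d / 2)} →
  (cdc₁ : IsConstantDimensionCode v₁ N₁ d₁ k C₁) →
  (cdc₂ : IsConstantDimensionCode v₂ N₂ d₂ k C₂) →
  IsRankMetricCode k (v₂ ∸ k + d / 2) Nᵣ dᵣ Cᵣ → IsLinear Cᵣ →
  let open IsConstantDimensionCode
      δ = d₁ ⊓∞ d₂ ⊓∞ 2*∞ dᵣ ⊓∞ [ d ]
  in
  0 < d → δ ≤∞ [ 2 * k ] →
  ∃[ d′ ]
    ( IsConstantDimensionCode (v₁ + v₂ ∸ k + d / 2) (N₁ * Nᵣ + N₂) d′ k
        (linkage (k≤v cdc₁) (k≤v cdc₂) (d / 2) C₁ C₂ Cᵣ)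
    × δ ≤∞ d′
    × (d₁ ⊓∞ d₂ ⊓∞ 2*∞ dᵣ ≤∞ [ d ] → d′ ≡ δ) )
theorem18 _ F 2∣d cdc₁ cdc₂ rmc linear 0<d δ≤2k =
  Linkage.linkage-isCode F cdc₁ cdc₂ rmc linear (m*[n/m]≡n 2∣d) 0<d δ≤2k
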